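{- The Enumeration Based Search Algorithm for a girth maximum $(m,3)$ BTU in $Z(m,3)$, where $m=bk^2$, is in EXPTIME; that is, its running time is bounded by $2^{P(m)}$ for some polynomial $P$.
   Context: An $(m,r)$ BTU is an $r$-regular bipartite graph with $m$ vertices on each side, equivalently an $m\times m$ $0/1$ matrix with exactly $r$ nonzero entries in every row and column. Its girth is the length of a shortest cycle. A labeled $(m,r)$ BTU is girth maximum if no labeled $(m,r)$ BTU has larger girth. Permutations are in one-line notation $p=(x_1\ldots x_m)$, with permutation matrix having ones in positions $(i,x_i)$; $I_m$ is the identity. Two permutations $(x_1\ldots x_m),(y_1\ldots y_m)$ are compatible if $x_i\ne y_i$ for all $i$; pairwise compatible $p_1,\dots,p_r$ represent the BTU whose matrix is the sum of their permutation matrices. The partition between two compatible permutations of $S_m$ is the partition of $m$ whose parts are half the lengths of the cycles of the $(m,2)$ BTU they represent. For $q\in S_n$ and a positive integer $c$, $c\ast q\in S_{cn}$ has block diagonal matrix with $c$ copies of the matrix of $q$. $C_j\in S_m$ ($1\le j<m$) is the permutation whose matrix is obtained from the identity matrix by moving the last $j$ rows to the top. Let $m=bk^2$ with $b,k\in\mathbb{N}$ and $b$ minimal; assume $m$ is composite, $k\ge2$ and $3<m/2$. $Z(m,3)$ is the family of labeled $(m,3)$ BTUs represented by pairwise compatible $p_1,p_2,p_3\in S_m$ with $p_2=I_m$, $p_1=k\ast q_1$ for some $q_1\in S_{bk}$, the partition between $p_1$ and $p_2$ consisting of $k$ parts equal to $bk$, and the partition between $p_2$ and $p_3$ equal to $(m)$.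 The algorithm: on input $m$, compute $b$ and $k$; set $p_2=I_m$ and $p_3=C_j$ for a $j$ coprime to $m$ with $\min(m-j,j)>bk$; enumerate the permutations $q_1\in S_{bk}$ for which the partition between $q_1$ and $I_{bk}$ is $(bk)$ and for which $p_1=k\ast q_1$, $p_2$, $p_3$ form an $(m,3)$ BTU, compute the girth of each of these BTUs, and output one of largest girth. -}

module Defs where

open import Data.Bool using (Bool; true; false; if_then_else_)
open import Data.Empty using (⊥)
open import Data.List using (List; []; _∷_; _++_; [_]; map; concat; concatMap; drop; foldr; length; replicate; take; upTo; zip)
open import Data.List.Membership.Propositional using (_∈_)
open import Data.List.Relation.Binary.Permutation.Propositional using (_↭_)
open import Data.List.Relation.Binary.Pointwise using (Pointwise)
open import Data.List.Relation.Unary.All using (All)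
open import Data.List.Relation.Unary.AllPairs using (AllPairs)
open import Data.List.Relation.Unary.Linked using (Linked)
open import Data.List.Relation.Unary.Unique.Propositional using (Unique)
open import Data.Maybe using (Maybe; just; nothing)
open import Data.Nat using (ℕ; zero; suc; _+_; _*_; _∸_; _^_; _⊓_; _≤_; _<_; _≡ᵇ_; _<ᵇ_)
open import Data.Nat.Coprimality using (Coprime)
open import Data.Nat.Primality using (Composite)
open import Data.Product using (_×_; _,_; ∃-syntax)
open import Relation.Binary.PropositionalEquality using (_≡_; _≢_)
open import Relation.Nullary using (¬_)

-- Indices are 0-based: (x₁ … xₘ) is the list x₁ - 1 ∷ … ∷ xₘ - 1 ∷ [].

OneLine : Set
OneLine = List ℕ

Perm : ℕ → OneLine → Set
Perm m p = p ↭ upTo m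

I : ℕ → OneLine
I m = upTo m

-- Row i of a permutation matrix is determined by the i-th entry, so moving
-- the last j rows to the top moves the last j entries to the front.
C : ℕ → ℕ → OneLine
C m j = drop (m ∸ j) (I m) ++ take (m ∸ j) (I m)

-- The t-th diagonal block occupies rows and columns t * n, …, t * n + n - 1,
-- where n = length q.
infixr 7 _∗_
_∗_ : ℕ → OneLine → OneLine
c ∗ q = concatMap (λ t → map (t * length q +_) q) (upTo c)

Compatible : OneLine → OneLine → Set
Compatible = Pointwise _≢_

FormBTU : ℕ → ℕ → List OneLine → Set
FormBTU m r ps = length ps ≡ r × All (Perm m) ps × AllPairs Compatible ps

-- Positions (row , column) of the ones.
ones : OneLine → List (ℕ × ℕ)
ones p = zip (upTo (length p)) p

-- For pairwise compatible permutations these are exactly the nonzero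
-- entries of the sum of the permutation matrices.
edges : List OneLine → List (ℕ × ℕ)
edges = concatMap ones

Vertex : Set
Vertex = Bool × ℕ

pattern row i = true , i
pattern col x = false , x

vertices : ℕ → List Vertex
vertices m = map (true ,_) (upTo m) ++ map (false ,_) (upTo m)

data Adjacent (ps : List OneLine) : Vertex → Vertex → Set where
  row-col : ∀ {i x} → (i , x) ∈ edges ps → Adjacent ps (row i) (col x)
  col-row : ∀ {i x} → (i , x) ∈ edges ps → Adjacent ps (col x) (row i)

IsCycle : List OneLine → List Vertex → Set
IsCycle ps []       = ⊥
IsCycle ps (v ∷ vs) =
  3 ≤ length (v ∷ vs) × Unique (v ∷ vs) × Linked (Adjacent ps) (v ∷ vs ++ [ v ])

Girth : List OneLine → ℕ → Set
Girth ps g =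
  (∃[ c ] IsCycle ps c × length c ≡ g) × (∀ c → IsCycle ps c → g ≤ length c)

-- The cycles of the (m,2) BTU are its connected components: together they
-- visit every vertex exactly once.
PartitionBetween : ℕ → OneLine → OneLine → List ℕ → Set
PartitionBetween m p q parts =
  FormBTU m 2 (p ∷ q ∷ []) ×
  ∃[ cs ] All (IsCycle (p ∷ q ∷ [])) cs × concat cs ↭ vertices m
        × map length cs ↭ map (2 *_) parts

record Admissible (m b k : ℕ) : Set where
  field
    m≡bk²     : m ≡ b * k ^ 2
    b-minimal : ∀ b′ k′ → m ≡ b′ * k′ ^ 2 → b ≤ b′
    composite : Composite m
    2≤k       : 2 ≤ k
    3<m/2     : 2 * 3 < m

Triple : Set
Triple = OneLine × OneLine × OneLine

listing : Triple → List OneLine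
listing (p₁ , p₂ , p₃) = p₁ ∷ p₂ ∷ p₃ ∷ []

Z[_,3] : (m : ℕ) {b k : ℕ} → Admissible m b k → Triple → Set
Z[ m ,3] {b} {k} _ (p₁ , p₂ , p₃) =
  FormBTU m 3 (p₁ ∷ p₂ ∷ p₃ ∷ []) ×
  p₂ ≡ I m ×
  (∃[ q₁ ] Perm (b * k) q₁ × p₁ ≡ k ∗ q₁) ×
  PartitionBetween m p₁ p₂ (replicate k (b * k)) ×
  PartitionBetween m p₂ p₃ [ m ]

ValidShift : ℕ → ℕ → ℕ → ℕ → Set
ValidShift m b k j = (1 ≤ j × j < m) × Coprime j m × b * k < (m ∸ j) ⊓ j

triple : ℕ → ℕ → ℕ → OneLine → Triple
triple m k j q₁ = k ∗ q₁ , I m , C m j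

record Enumerated (m b k j : ℕ) (q₁ : OneLine) : Set where
  field
    perm      : Perm (b * k) q₁
    partition : PartitionBetween (b * k) q₁ (I (b * k)) [ b * k ]
    btu       : FormBTU m 3 (listing (triple m k j q₁))

-- The algorithm cannot proceed when no valid j exists (this happens for
-- k = 2), and has nothing to choose from when no q₁ is enumerated.
data IsOutput {m b k : ℕ} (A : Admissible m b k) : Maybe Triple → Set where
  no-shift : (∀ j → ¬ ValidShift m b k j) → IsOutput A nothing
  no-q₁    : ∀ j → ValidShift m b k j →
             (∀ q₁ → ¬ Enumerated m b k j q₁) → IsOutput A nothing
  largest  : ∀ j q₁ → ValidShift m b k j → Enumerated m b k j q₁ →
             (∀ q₁′ g g′ → Enumerated m b k j q₁′ →
               Girth (listing (triple m k j q₁)) g →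
               Girth (listing (triple m k j q₁′)) g′ → g′ ≤ g) →
             Z[ m ,3] A (triple m k j q₁) →
             IsOutput A (just (triple m k j q₁))

infixr 6 _⊗_

data Ty : Set where
  nat bool   : Ty
  list maybe : Ty → Ty
  _⊗_        : Ty → Ty → Ty

⟦_⟧ : Ty → Set
⟦ nat ⟧     = ℕ
⟦ bool ⟧    = Bool
⟦ list α ⟧  = List ⟦ α ⟧
⟦ maybe α ⟧ = Maybe ⟦ α ⟧
⟦ α ⊗ β ⟧   = ⟦ α ⟧ × ⟦ β ⟧

-- Parametric higher-order abstract syntax: variables are drawn from an
-- abstract family V, so a term cannot inspect the values it will be run on
-- and every computation has to go through the constructors below.
data Tm (V : Ty → Set) : Ty → Set where
  var             : ∀ {α} → V α → Tm V α
  bind            : ∀ {α β} → Tm V α → (V α → Tm V β) → Tm V β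
  lit             : ℕ → Tm V nat
  add mul sub     : Tm V nat → Tm V nat → Tm V nat
  eq lt           : Tm V nat → Tm V nat → Tm V bool
  yes no          : Tm V bool
  ite             : ∀ {α} → Tm V bool → Tm V α → Tm V α → Tm V α
  pair            : ∀ {α β} → Tm V α → Tm V β → Tm V (α ⊗ β)
  fst             : ∀ {α β} → Tm V (α ⊗ β) → Tm V α
  snd             : ∀ {α β} → Tm V (α ⊗ β) → Tm V β
  none            : ∀ {α} → Tm V (maybe α)
  some            : ∀ {α} → Tm V α → Tm V (maybe α)
  caseMaybe       : ∀ {α β} → Tm V (maybe α) → Tm V β → (V α → Tm V β) → Tm V β
  nil             : ∀ {α} → Tm V (list α)
  cons            : ∀ {α} → Tm V α → Tm V (list α) → Tm V (list α)
  recNat          : ∀ {α} → Tm V nat → Tm V α → (V nat → V α → Tm V α) → Tm V α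
  recList         : ∀ {α β} → Tm V (list α) → Tm V β →
                    (V α → V (list α) → V β → Tm V β) → Tm V β

Program : Ty → Ty → Set₁
Program α β = ∀ {V : Ty → Set} → V α → Tm V β

record Timed (A : Set) : Set where
  constructor _after_
  field
    value : A
    time  : ℕ

open Timed public

return : ∀ {A} → A → Timed A
return a = a after 0

infixl 1 _>>=_
_>>=_ : ∀ {A B} → Timed A → (A → Timed B) → Timed B
(a after s) >>= f = value (f a) after (s + time (f a))

charge : ∀ {A} → ℕ → Timed A → Timed A
charge n (a after s) = a after (n + s)

-- An arithmetic operation is charged the magnitudes of its operands and
-- result on top of the unit step, as for numbers written in unary.
arith : (ℕ → ℕ → ℕ) → ℕ → ℕ → Timed ℕ
arith _∙_ x y = (x ∙ y) after (x + y + (x ∙ y))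

test : (ℕ → ℕ → Bool) → ℕ → ℕ → Timed Bool
test _∙_ x y = (x ∙ y) after (x + y)

iterNat : ∀ {A : Set} → Timed A → (ℕ → A → Timed A) → ℕ → Timed A
iterNat z s zero    = z
iterNat z s (suc n) = iterNat z s n >>= λ r → charge 1 (s n r)

iterList : ∀ {A B : Set} → Timed B → (A → List A → B → Timed B) → List A → Timed B
iterList z s []       = z
iterList z s (x ∷ xs) = iterList z s xs >>= λ r → charge 1 (s x xs r)

eval : ∀ {α} → Tm ⟦_⟧ α → Timed ⟦ α ⟧
step : ∀ {α} → Tm ⟦_⟧ α → Timed ⟦ α ⟧

-- Each evaluation of a term constructor is one step, each iteration of a
-- recursor another one.
eval t = charge 1 (step t)

step (var a)           = return a
step (bind t u)        = eval t >>= λ a → eval (u a)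
step (lit n)           = return n
step (add t u)         = eval t >>= λ x → eval u >>= λ y → arith _+_ x y
step (mul t u)         = eval t >>= λ x → eval u >>= λ y → arith _*_ x y
step (sub t u)         = eval t >>= λ x → eval u >>= λ y → arith _∸_ x y
step (eq t u)          = eval t >>= λ x → eval u >>= λ y → test _≡ᵇ_ x y
step (lt t u)          = eval t >>= λ x → eval u >>= λ y → test _<ᵇ_ x y
step yes               = return true
step no                = return false
step (ite c t u)       = eval c >>= λ b → if b then eval t else eval u
step (pair t u)        = eval t >>= λ a → eval u >>= λ b → return (a , b)
step (fst t)           = eval t >>= λ { (a , _) → return a }
step (snd t)           = eval t >>= λ { (_ , b) → return b }
step none              = return nothing
step (some t)          = eval t >>= λ a → return (just a)
step (caseMaybe t n j) = eval t >>= λ { nothing → eval n ; (just a) → eval (j a) }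
step nil               = return []
step (cons t u)        = eval t >>= λ a → eval u >>= λ as → return (a ∷ as)
step (recNat t z s)    = eval t >>= iterNat (eval z) (λ n r → eval (s n r))
step (recList t z s)   = eval t >>= iterList (eval z) (λ x xs r → eval (s x xs r))

run : ∀ {α β} → Program α β → ⟦ α ⟧ → Timed ⟦ β ⟧
run p a = eval (p a)

-- The definitions in this module are abbreviations for terms; they are
-- expanded before evaluation, and their expansions are charged in full.
module Code {V : Ty → Set} where

  private variable
    α β : Ty

  Nat Flag Line Edge Node Path : Set
  Nat  = Tm V nat
  Flag = Tm V bool
  Line = Tm V (list nat)
  Edge = Tm V (nat ⊗ nat)
  Node = Tm V (bool ⊗ nat)
  Path = Tm V (list (bool ⊗ nat))

  Edges : Set
  Edges = Tm V (list (nat ⊗ nat))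

  letᵗ : Tm V α → (Tm V α → Tm V β) → Tm V β
  letᵗ t f = bind t λ a → f (var a)

  infixr 6 _∧ᵗ_
  infixr 5 _∨ᵗ_

  notᵗ : Flag → Flag
  notᵗ s = ite s no yes

  _∧ᵗ_ _∨ᵗ_ : Flag → Flag → Flag
  s ∧ᵗ t = ite s t no
  s ∨ᵗ t = ite s yes t

  foldᵗ : (Tm V α → Tm V β → Tm V β) → Tm V β → Tm V (list α) → Tm V β
  foldᵗ f z xs = recList xs z λ x _ r → f (var x) (var r)

  anyᵗ : (Tm V α → Flag) → Tm V (list α) → Flag
  anyᵗ p = foldᵗ (λ x r → p x ∨ᵗ r) no

  mapᵗ : (Tm V α → Tm V β) → Tm V (list α) → Tm V (list β)
  mapᵗ f = foldᵗ (λ x r → cons (f x) r) nil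

  filterᵗ : (Tm V α → Flag) → Tm V (list α) → Tm V (list α)
  filterᵗ p = foldᵗ (λ x r → ite (p x) (cons x r) r) nil

  infixr 5 _++ᵗ_
  _++ᵗ_ : Tm V (list α) → Tm V (list α) → Tm V (list α)
  xs ++ᵗ ys = foldᵗ cons ys xs

  concatMapᵗ : (Tm V α → Tm V (list β)) → Tm V (list α) → Tm V (list β)
  concatMapᵗ f = foldᵗ (λ x r → f x ++ᵗ r) nil

  upToᵗ : Nat → Line
  upToᵗ n = recNat n nil λ i r → var r ++ᵗ cons (var i) nil

  leastᵗ : Nat → (Nat → Flag) → Tm V (maybe nat)
  leastᵗ n p = recNat n none λ i r →
    caseMaybe (var r) (ite (p (var i)) (some (var i)) none) (λ j → some (var j))

  dividesᵗ : Nat → Nat → Flag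
  dividesᵗ d n = anyᵗ (λ q → eq (mul q d) n) (upToᵗ (add n (lit 1)))

  coprimeᵗ : Nat → Nat → Flag
  coprimeᵗ i n = notᵗ (anyᵗ (λ d → lt (lit 1) d ∧ᵗ dividesᵗ d i ∧ᵗ dividesᵗ d n)
                            (upToᵗ (add n (lit 1))))

  insertionsᵗ : Nat → Line → Tm V (list (list nat))
  insertionsᵗ x ys = recList ys (cons (cons x nil) nil) λ z zs r →
    cons (cons x (cons (var z) (var zs))) (mapᵗ (cons (var z)) (var r))

  permutationsᵗ : Nat → Tm V (list (list nat))
  permutationsᵗ n = recNat n (cons nil nil) λ i r → concatMapᵗ (insertionsᵗ (var i)) (var r)

  blocksᵗ : Nat → Nat → Line → Line
  blocksᵗ c n q = concatMapᵗ (λ t → mapᵗ (add (mul t n)) q) (upToᵗ c)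

  shiftᵗ : Nat → Nat → Line
  shiftᵗ m j = mapᵗ (add (sub m j)) (upToᵗ j) ++ᵗ upToᵗ (sub m j)

  onesᵗ : Line → Edges
  onesᵗ = foldᵗ (λ x r → cons (pair (lit 0) x)
                              (mapᵗ (λ e → pair (add (lit 1) (fst e)) (snd e)) r)) nil

  sameEdgeᵗ : Edge → Edge → Flag
  sameEdgeᵗ e f = eq (fst e) (fst f) ∧ᵗ eq (snd e) (snd f)

  compatibleᵗ : Line → Line → Flag
  compatibleᵗ p q = letᵗ (onesᵗ q) λ es →
    notᵗ (anyᵗ (λ e → anyᵗ (sameEdgeᵗ e) es) (onesᵗ p))

  verticesᵗ : Nat → Path
  verticesᵗ m = mapᵗ (pair yes) (upToᵗ m) ++ᵗ mapᵗ (pair no) (upToᵗ m)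

  sameVertexᵗ : Node → Node → Flag
  sameVertexᵗ u v = ite (fst u) (fst v) (notᵗ (fst v)) ∧ᵗ eq (snd u) (snd v)

  adjacentᵗ : Edges → Node → Node → Flag
  adjacentᵗ es u v = anyᵗ (λ e → (joins e u v) ∨ᵗ (joins e v u)) es
    where
    joins : Edge → Node → Node → Flag
    joins e r c = sameVertexᵗ r (pair yes (fst e)) ∧ᵗ sameVertexᵗ c (pair no (snd e))

  headAdjacentᵗ : Edges → Node → Path → Flag
  headAdjacentᵗ es v p = recList p no λ u _ _ → adjacentᵗ es v (var u)

  -- All simple paths from s with l edges, listed from the far end back to s.
  simplePathsᵗ : Edges → Path → Node → Nat → Tm V (list (list (bool ⊗ nat)))
  simplePathsᵗ es vs s l = recNat l (cons (cons s nil) nil) λ _ r →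
    concatMapᵗ (λ p → mapᵗ (λ v → cons v p)
                           (filterᵗ (λ v → headAdjacentᵗ es v p ∧ᵗ
                                           notᵗ (anyᵗ (sameVertexᵗ v) p)) vs))
               (var r)

  hasCycleᵗ : Edges → Path → Nat → Flag
  hasCycleᵗ es vs l =
    lt (lit 2) l ∧ᵗ
    anyᵗ (λ s → anyᵗ (headAdjacentᵗ es s) (simplePathsᵗ es vs s (sub l (lit 1)))) vs

  -- The partition between q and the identity is (n) exactly when their
  -- (n,2) BTU has a cycle through all 2n vertices.
  partitionIsFullᵗ : Nat → Line → Flag
  partitionIsFullᵗ n q =
    compatibleᵗ q (upToᵗ n) ∧ᵗ
    (letᵗ (onesᵗ q ++ᵗ onesᵗ (upToᵗ n)) λ es →
     letᵗ (verticesᵗ n) λ vs →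
     hasCycleᵗ es vs (mul (lit 2) n))

  -- No cycle is longer than 2m; a BTU without cycles, which does not occur
  -- here, is given the value 2m + 1.
  girthᵗ : Nat → Edges → Nat
  girthᵗ m edgeList =
    letᵗ edgeList λ es →
    letᵗ (verticesᵗ m) λ vs →
    letᵗ (add (mul (lit 2) m) (lit 1)) λ bound →
    caseMaybe (leastᵗ bound (hasCycleᵗ es vs)) bound var

  searchᵗ : Nat → Nat → Nat → Nat → Tm V (maybe (list nat ⊗ list nat ⊗ list nat))
  searchᵗ m b k j =
    letᵗ (mul b k) λ n →
    letᵗ (upToᵗ m) λ p₂ →
    letᵗ (shiftᵗ m j) λ p₃ →
    letᵗ (mapᵗ (blocksᵗ k n) (filterᵗ (partitionIsFullᵗ n) (permutationsᵗ n))) λ p₁s →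
    letᵗ (filterᵗ (λ p₁ → compatibleᵗ p₁ p₂ ∧ᵗ compatibleᵗ p₁ p₃ ∧ᵗ compatibleᵗ p₂ p₃) p₁s) λ good →
    letᵗ (mapᵗ (λ p₁ → pair (girthᵗ m (onesᵗ p₁ ++ᵗ onesᵗ p₂ ++ᵗ onesᵗ p₃)) p₁) good) λ scored →
    caseMaybe
      (foldᵗ (λ x best → caseMaybe best (some x) λ y →
                ite (lt (fst (var y)) (fst x)) (some x) (some (var y)))
             none scored)
      none
      (λ x → some (pair (snd (var x)) (pair p₂ p₃)))

  orStop : Tm V (maybe α) → (Tm V α → Tm V (maybe β)) → Tm V (maybe β)
  orStop t f = caseMaybe t none λ a → f (var a)

-- The least valid j is used.
enumerationSearch : Program nat (maybe (list nat ⊗ list nat ⊗ list nat))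
enumerationSearch x =
  letᵗ (var x) λ m →
  letᵗ (add m (lit 1)) λ m+1 →
  orStop (leastᵗ m+1 λ b → anyᵗ (λ k → eq m (mul b (mul k k))) (upToᵗ m+1)) λ b →
  orStop (leastᵗ m+1 λ k → eq m (mul b (mul k k))) λ k →
  letᵗ (mul b k) λ n →
  orStop (leastᵗ m λ j → coprimeᵗ j m ∧ᵗ lt n j ∧ᵗ lt n (sub m j)) λ j →
  searchᵗ m b k j
  where open Code

output : Program nat (maybe (list nat ⊗ list nat ⊗ list nat)) → ℕ → Maybe Triple
output p m = value (run p m)

steps : ∀ {β} → Program nat β → ℕ → ℕ
steps p m = time (run p m)

Implements-search : Program nat (maybe (list nat ⊗ list nat ⊗ list nat)) → Set
Implements-search p = ∀ m b k (A : Admissible m b k) → IsOutput A (output p m)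

-- Coefficients, constant term first.
Polynomial : Set
Polynomial = List ℕ

infix 8 _at_
_at_ : Polynomial → ℕ → ℕ
P at x = foldr (λ a r → a + x * r) 0 P

-- Time is measured against m itself, not against the length of its binary
-- representation.
In-EXPTIME : ∀ {β} → Program nat β → Set
In-EXPTIME p = ∃[ P ] (∀ m b k → Admissible m b k → steps p m ≤ 2 ^ (P at m))

{-# OPTIONS --safe #-}
module Submission where

-- Each term constructor preserves the shape “evaluates to v in time at most B^e,
-- with all data in v of size at most B^e” for an exponent e that does not depend
-- on m, provided that every intermediate list is that short. Taking B = 2^((m+2)²)
-- makes this true of the two exponentially long lists, the permutations of at
-- most m points and the simple paths on at most 2m vertices, so the running time
-- is at most 2^(E (m+2)²) for a constant E.
--
-- For correctness, flags evaluate to decisions of the properties they test, and a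
-- cycle is exactly a simple path whose ends are joined. The output lies in Z(m,3)
-- because the k translates of a Hamiltonian cycle of (q₁ , I) partition
-- (k ∗ q₁ , I), and stepping by j through ℤ/m gives one of (I , C_j).

open import Defs
open import Data.Bool as Bool using (Bool; true; false; if_then_else_; _∧_; _∨_; not)
open import Data.Empty using (⊥)
open import Data.List hiding (find; partition)
open import Data.List.Membership.Propositional using (_∈_; find; lose)
open import Data.List.Membership.Propositional.Properties
open import Data.List.Properties
open import Data.List.Relation.Binary.Permutation.Propositional
  using (_↭_; ↭-refl; ↭-sym; ↭-trans; ↭-prep; ↭-reflexive; ↭⇒↭ₛ)
open import Data.List.Relation.Binary.Permutation.Propositional.Properties as Permₚ
  using (↭-length; ∈-resp-↭; shift; drop-∷; ↭-singleton-inv)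
import Data.List.Relation.Binary.Permutation.Setoid.Properties as Permₛ
open import Data.List.Relation.Binary.Pointwise using ([]; _∷_)
open import Data.List.Relation.Unary.All as All using (All; []; _∷_)
import Data.List.Relation.Unary.All.Properties as Allₚ
open import Data.List.Relation.Unary.AllPairs using ([]; _∷_)
open import Data.List.Relation.Unary.Any as Any using (Any; here; there; any?)
open import Data.List.Relation.Unary.Linked as Linked using (Linked; [-]; _∷_)
import Data.List.Relation.Unary.Linked.Properties as Linkedₚ
open import Data.List.Relation.Unary.Unique.Propositional using (Unique)
import Data.List.Relation.Unary.Unique.Propositional.Properties as Uniqueₚ
open import Data.Maybe using (Maybe; just; nothing; maybe′)
import Data.Maybe.Relation.Unary.All as MAll
open MAll using (just; nothing)
open import Data.Nat
open import Data.Nat.Coprimality as Coprimality using (Coprime; coprime-divisor)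
open import Data.Nat.Divisibility using (_∣_; _∣?_; divides; ∣⇒≤; 0∣⇒≡0)
open import Data.Nat.DivMod
open import Data.Nat.Properties
open import Data.Nat.Solver using (module +-*-Solver)
open import Data.Product using (∃-syntax; _×_; _,_; proj₁; proj₂; uncurry)
open import Data.Product.Properties using (,-injective)
open import Data.Sum as Sum using (_⊎_; inj₁; inj₂)
open import Data.Unit using (⊤; tt)
open import Function using (id; _∘_; mk⇔)
open import Level using (0ℓ)
open import Relation.Binary.Definitions using (DecidableEquality; tri<; tri≈; tri>)
open import Relation.Binary.PropositionalEquality hiding ([_])
open import Relation.Nullary as Nullary hiding (yes; no)
open import Relation.Nullary.Decidable as Dec using (does-⇔)
open import Relation.Unary using (Pred; Decidable)

-- The program is compared with a plain function, `algorithm`, which follows the same recursions but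
-- uses decisions of propositions in place of flags. Values and times have to be bounded together,
-- since the cost of a term depends on the data it receives: arithmetic is charged by magnitude and
-- recursors by the number of iterations. Powers of B suit this because, for B at least 2, a sum
-- raises the larger exponent by one and a product adds exponents, so a fixed term shifts exponents
-- by an amount fixed by its shape. Iteration is the obstacle. Bounding an accumulator by composing
-- the step with itself would let the exponent grow with the number of iterations, hence with m. The
-- rules for recursors therefore ask for one exponent valid for all accumulators, justified by what
-- these are: an initial range, a partial enumeration, a list of paths.

least : ∀ {P : Pred ℕ 0ℓ} → Decidable P → ℕ → Maybe ℕ
least P? zero    = nothing
least P? (suc n) = maybe′ just (if does (P? n) then just n else nothing) (least P? n)

insertions : ℕ → List ℕ → List (List ℕ)
insertions x []       = [ [ x ] ]
insertions x (y ∷ ys) = (x ∷ y ∷ ys) ∷ map (y ∷_) (insertions x ys)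

permutations : ℕ → List (List ℕ)
permutations zero    = [ [] ]
permutations (suc n) = concatMap (insertions n) (permutations n)

EdgeList : Set
EdgeList = List (ℕ × ℕ)

infix 4 _≟ᵉ_ _≟ᵛ_

-- Built so that `does` computes to the conjunction of the two component tests, the shape of the
-- flag that `sameEdgeᵗ` evaluates.
×-≡-dec : ∀ {A B : Set} → DecidableEquality A → DecidableEquality B → DecidableEquality (A × B)
×-≡-dec _≟₁_ _≟₂_ (a , b) (c , d) =
  Dec.map′ (uncurry (cong₂ _,_)) ,-injective ((a ≟₁ c) ×-dec (b ≟₂ d))

_≟ᵉ_ : (e f : ℕ × ℕ) → Dec (e ≡ f)
_≟ᵉ_ = ×-≡-dec _≟_ _≟_

_≟ᵛ_ : (u v : Vertex) → Dec (u ≡ v)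
_≟ᵛ_ = ×-≡-dec Bool._≟_ _≟_

-- The property that `compatibleᵗ` tests. It compares lists of edges and so, unlike `Compatible`,
-- does not force equal lengths.
NoCommonEdge : OneLine → OneLine → Set
NoCommonEdge p q = ¬ Any (λ e → Any (e ≡_) (ones q)) (ones p)

noCommonEdge? : ∀ p q → Dec (NoCommonEdge p q)
noCommonEdge? p q = ¬? (any? (λ e → any? (e ≟ᵉ_) (ones q)) (ones p))

Joins : ℕ × ℕ → Vertex → Vertex → Set
Joins e u v = u ≡ row (proj₁ e) × v ≡ col (proj₂ e)

joins? : ∀ e u v → Dec (Joins e u v)
joins? e u v = (u ≟ᵛ row (proj₁ e)) ×-dec (v ≟ᵛ col (proj₂ e))

Joined : EdgeList → Vertex → Vertex → Set
Joined es u v = Any (λ e → Joins e u v ⊎ Joins e v u) es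

joined? : ∀ es u v → Dec (Joined es u v)
joined? es u v = any? (λ e → joins? e u v ⊎-dec joins? e v u) es

HeadJoined : EdgeList → Vertex → List Vertex → Set
HeadJoined es v []      = ⊥
HeadJoined es v (u ∷ _) = Joined es v u

headJoined? : ∀ es v p → Dec (HeadJoined es v p)
headJoined? es v []      = Nullary.no λ ()
headJoined? es v (u ∷ _) = joined? es v u

Extends : EdgeList → List Vertex → Vertex → Set
Extends es p v = HeadJoined es v p × ¬ Any (v ≡_) p

extends? : ∀ es p v → Dec (Extends es p v)
extends? es p v = headJoined? es v p ×-dec ¬? (any? (v ≟ᵛ_) p)

simplePaths : EdgeList → List Vertex → Vertex → ℕ → List (List Vertex)
simplePaths es vs s zero    = [ [ s ] ]
simplePaths es vs s (suc l) =
  concatMap (λ p → map (_∷ p) (filter (extends? es p) vs)) (simplePaths es vs s l)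

HasCycle : EdgeList → List Vertex → ℕ → Set
HasCycle es vs l = 2 < l × Any (λ s → Any (HeadJoined es s) (simplePaths es vs s (l ∸ 1))) vs

hasCycle? : ∀ es vs l → Dec (HasCycle es vs l)
hasCycle? es vs l =
  (2 <? l) ×-dec any? (λ s → any? (headJoined? es s) (simplePaths es vs s (l ∸ 1))) vs

Full : ℕ → OneLine → Set
Full n q = NoCommonEdge q (upTo n) × HasCycle (ones q ++ ones (upTo n)) (vertices n) (2 * n)

full? : ∀ n q → Dec (Full n q)
full? n q = noCommonEdge? q (upTo n) ×-dec hasCycle? (ones q ++ ones (upTo n)) (vertices n) (2 * n)

girth : ℕ → EdgeList → ℕ
girth m es = maybe′ id (2 * m + 1) (least (hasCycle? es (vertices m)) (2 * m + 1))

blocks : ℕ → ℕ → OneLine → OneLine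
blocks c n q = concatMap (λ t → map (t * n +_) q) (upTo c)

cyclicShift : ℕ → ℕ → OneLine
cyclicShift m j = map (m ∸ j +_) (upTo j) ++ upTo (m ∸ j)

better : ∀ {A : Set} → ℕ × A → Maybe (ℕ × A) → Maybe (ℕ × A)
better x = maybe′ (λ y → if does (proj₁ y <? proj₁ x) then just x else just y) (just x)

best : ∀ {A : Set} → List (ℕ × A) → Maybe (ℕ × A)
best = foldr better nothing

Disjoint₃ : OneLine → OneLine → OneLine → Set
Disjoint₃ p q r = NoCommonEdge p q × NoCommonEdge p r × NoCommonEdge q r

disjoint₃? : ∀ p q r → Dec (Disjoint₃ p q r)
disjoint₃? p q r = noCommonEdge? p q ×-dec noCommonEdge? p r ×-dec noCommonEdge? q r

candidates : ℕ → ℕ → ℕ → ℕ → List OneLine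
candidates m b k j =
  filter (λ p → disjoint₃? p (upTo m) (cyclicShift m j))
    (map (blocks k (b * k)) (filter (full? (b * k)) (permutations (b * k))))

score : ℕ → ℕ → OneLine → ℕ × OneLine
score m j p = girth m (ones p ++ ones (upTo m) ++ ones (cyclicShift m j)) , p

searchResult : ℕ → ℕ → ℕ → ℕ → Maybe Triple
searchResult m b k j =
  maybe′ (λ x → just (proj₂ x , upTo m , cyclicShift m j)) nothing
    (best (map (score m j) (candidates m b k j)))

CommonDivisor : ℕ → ℕ → ℕ → Set
CommonDivisor i n d = 1 < d × d ∣ i × d ∣ n

Coprime′ : ℕ → ℕ → Set
Coprime′ i n = ¬ Any (CommonDivisor i n) (upTo (n + 1))

coprime′? : ∀ i n → Dec (Coprime′ i n)
coprime′? i n = ¬? (any? (λ d → (1 <? d) ×-dec (d ∣? i) ×-dec (d ∣? n)) (upTo (n + 1)))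

Shift : ℕ → ℕ → ℕ → Set
Shift m n j = Coprime′ j m × n < j × n < m ∸ j

shift? : ∀ m n j → Dec (Shift m n j)
shift? m n j = coprime′? j m ×-dec (n <? j) ×-dec (n <? m ∸ j)

Square : ℕ → ℕ → ℕ → Set
Square m b k = m ≡ b * (k * k)

square? : ∀ m b k → Dec (Square m b k)
square? m b k = m ≟ b * (k * k)

algorithm : ℕ → Maybe Triple
algorithm m =
  maybe′ (λ b →
    maybe′ (λ k →
      maybe′ (searchResult m b k) nothing (least (shift? m (b * k)) m))
      nothing (least (square? m b) (m + 1)))
    nothing (least (λ b → any? (square? m b) (upTo (m + 1))) (m + 1))

-- Least witnesses

least-nothing : ∀ {P : Pred ℕ 0ℓ} (P? : Decidable P) n → least P? n ≡ nothing →
                ∀ {j} → j < n → ¬ P j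
least-nothing P? (suc n) e {j} j≤n with least P? n in e′ | P? n
least-nothing P? (suc n) () _ | just _ | _
least-nothing P? (suc n) () _ | nothing | Nullary.yes _
... | nothing | Nullary.no ¬p with m<1+n⇒m<n∨m≡n j≤n
...   | inj₁ j<n  = least-nothing P? n e′ j<n
...   | inj₂ refl = ¬p

least-just : ∀ {P : Pred ℕ 0ℓ} (P? : Decidable P) n {i} → least P? n ≡ just i →
             i < n × P i × (∀ {j} → j < i → ¬ P j)
least-just P? (suc n) e with least P? n in e′ | P? n
least-just P? (suc n) refl | just _ | _ =
  let i<n , rest = least-just P? n e′ in m<n⇒m<1+n i<n , rest
least-just P? (suc n) refl | nothing | Nullary.yes p = ≤-refl , p , least-nothing P? n e′
least-just P? (suc n) () | nothing | Nullary.no _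

least-exists : ∀ {P : Pred ℕ 0ℓ} (P? : Decidable P) n {i} → i < n → P i →
               ∃[ j ] least P? n ≡ just j
least-exists P? n i<n p with least P? n in e
... | just j  = j , refl
... | nothing = contradiction p (least-nothing P? n e i<n)

-- Turns the definition by `zip` into the recursion that `onesᵗ` follows: putting an entry in front
-- raises all later row numbers by one.
ones-∷ : ∀ x p → ones (x ∷ p) ≡ (0 , x) ∷ map (λ e → 1 + proj₁ e , proj₂ e) (ones p)
ones-∷ x p = cong ((0 , x) ∷_)
  (trans (cong (λ is → zip is p) (sym (map-upTo suc (length p)))) (zip-mapˡ suc (upTo (length p)) p))
  where
  zip-mapˡ : ∀ (f : ℕ → ℕ) (is p : List ℕ) → zip (map f is) p ≡ map (λ e → f (proj₁ e) , proj₂ e) (zip is p)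
  zip-mapˡ f []       p       = refl
  zip-mapˡ f (i ∷ is) []      = refl
  zip-mapˡ f (i ∷ is) (x ∷ p) = cong (_ ∷_) (zip-mapˡ f is p)

length-ones : ∀ p → length (ones p) ≡ length p
length-ones []      = refl
length-ones (x ∷ p) = trans (cong length (ones-∷ x p)) (cong suc (trans (length-map _ (ones p)) (length-ones p)))

length-vertices : ∀ k → length (vertices k) ≡ 2 * k
length-vertices k =
  trans (length-++ (side true)) (cong₂ _+_ (length-side true) (trans (length-side false) (sym (+-identityʳ k))))
  where
  side : Bool → List Vertex
  side b = map (b ,_) (upTo k)
  length-side : ∀ b → length (side b) ≡ k
  length-side b = trans (length-map _ (upTo k)) (length-upTo k)

-- Enumeration of permutations

insertions-sound : ∀ x ys {zs} → zs ∈ insertions x ys → zs ↭ x ∷ ys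
insertions-sound x []       (here refl) = ↭-refl
insertions-sound x (y ∷ ys) (here refl) = ↭-refl
insertions-sound x (y ∷ ys) (there zs∈) with ∈-map⁻ (y ∷_) zs∈
... | zs , zs∈′ , refl = ↭-trans (↭-prep y (insertions-sound x ys zs∈′)) (_↭_.swap y x ↭-refl)

insertions-complete : ∀ x as bs → as ++ x ∷ bs ∈ insertions x (as ++ bs)
insertions-complete x []       []       = here refl
insertions-complete x []       (b ∷ bs) = here refl
insertions-complete x (a ∷ as) bs       = there (∈-map⁺ (a ∷_) (insertions-complete x as bs))

∷↭upTo : ∀ n {q} → q ↭ upTo n → n ∷ q ↭ upTo (suc n)
∷↭upTo n p = ↭-trans (↭-prep n p) (↭-trans (Permₚ.∷↭∷ʳ n (upTo n)) (↭-reflexive (upTo-∷ʳ n)))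

permutations-sound : ∀ n {q} → q ∈ permutations n → q ↭ upTo n
permutations-sound zero    (here refl) = ↭-refl
permutations-sound (suc n) q∈ with find (∈-concatMap⁻ (insertions n) q∈)
... | q′ , q′∈ , q∈′ = ↭-trans (insertions-sound n q′ q∈′) (∷↭upTo n (permutations-sound n q′∈))

-- The largest value n occurs somewhere in q. Erasing it leaves a permutation of `upTo n`, and
-- inserting it at the same place gives q back.
permutations-complete : ∀ n {q} → q ↭ upTo n → q ∈ permutations n
permutations-complete zero    p rewrite Permₚ.↭-empty-inv p = here refl
permutations-complete (suc n) p
  with as , bs , refl ← ∈-∃++ (∈-resp-↭ (↭-sym p) (∈-upTo⁺ (n<1+n n))) =
  ∈-concatMap⁺ (insertions n) (lose (permutations-complete n as++bs↭) (insertions-complete n as bs))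
  where
  as++bs↭ : as ++ bs ↭ upTo n
  as++bs↭ = drop-∷ (↭-trans (↭-sym (shift n as bs)) (↭-trans p (↭-sym (∷↭upTo n ↭-refl))))

module _ {A : Set} where

  -- The pigeonhole principle with its remainder: each element of xs is removed from ys in turn, and
  -- `zs` is what is left over. Comparing lengths then bounds the length of a cycle, and an empty
  -- remainder shows that a long enough cycle visits everything.
  unique-⊆⇒↭ : ∀ {xs ys : List A} → Unique xs → All (_∈ ys) xs → ∃[ zs ] ys ↭ xs ++ zs
  unique-⊆⇒↭ {[]}     {ys} _          _           = ys , ↭-refl
  unique-⊆⇒↭ {x ∷ xs} (x∉xs ∷ !xs) (x∈ys ∷ xs⊆ys)
    with as , bs , refl ← ∈-∃++ x∈ys =
    let zs , p = unique-⊆⇒↭ !xs (All.zipWith (λ (x≢ , y∈) → avoid x≢ y∈) (x∉xs , xs⊆ys))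
    in zs , ↭-trans (shift x as bs) (↭-prep x p)
    where
    avoid : ∀ {y} → x ≢ y → y ∈ as ++ x ∷ bs → y ∈ as ++ bs
    avoid x≢y y∈ with ∈-++⁻ as y∈
    ... | inj₁ y∈as         = ∈-++⁺ˡ y∈as
    ... | inj₂ (here y≡x)   = contradiction (sym y≡x) x≢y
    ... | inj₂ (there y∈bs) = ∈-++⁺ʳ as y∈bs

  unique-⊆⇒length≤ : ∀ {xs ys : List A} → Unique xs → All (_∈ ys) xs → length xs ≤ length ys
  unique-⊆⇒length≤ {xs} !xs xs⊆ys with zs , p ← unique-⊆⇒↭ !xs xs⊆ys =
    subst (length xs ≤_) (sym (trans (↭-length p) (length-++ xs))) (m≤m+n _ _)

  unique-⊆-length⇒↭ : ∀ {xs ys : List A} → Unique xs → All (_∈ ys) xs →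
                      length xs ≡ length ys → xs ↭ ys
  unique-⊆-length⇒↭ {xs} !xs xs⊆ys l with unique-⊆⇒↭ !xs xs⊆ys
  ... | []     , p = ↭-trans (↭-reflexive (sym (++-identityʳ xs))) (↭-sym p)
  ... | z ∷ zs , p = contradiction (trans l (trans (↭-length p) (length-++ xs))) (m≢1+m+n (length xs) ∘ flip-suc)
    where
    flip-suc : length xs ≡ length xs + suc (length zs) → length xs ≡ suc (length xs + length zs)
    flip-suc e = trans e (+-suc (length xs) (length zs))

-- Compatible permutations

infix 4 _∈ones_

_∈ones_ : ℕ × ℕ → OneLine → Set
e ∈ones p = e ∈ ones p

∈ones-∷⁻ : ∀ {e x p} → e ∈ones (x ∷ p) → e ≡ (0 , x) ⊎ ∃[ f ] f ∈ones p × e ≡ (suc (proj₁ f) , proj₂ f)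
∈ones-∷⁻ {e} {x} {p} e∈ with subst (e ∈_) (ones-∷ x p) e∈
... | here e≡   = inj₁ e≡
... | there e∈′ = inj₂ (∈-map⁻ _ e∈′)

∈ones-zero : ∀ {x p} → (0 , x) ∈ones (x ∷ p)
∈ones-zero {x} {p} = subst ((0 , x) ∈_) (sym (ones-∷ x p)) (here refl)

∈ones-suc : ∀ {i y x p} → (i , y) ∈ones p → (suc i , y) ∈ones (x ∷ p)
∈ones-suc {i} {y} {x} {p} e∈ = subst ((suc i , y) ∈_) (sym (ones-∷ x p)) (there (∈-map⁺ _ e∈))

compatible⇒noCommonEdge : ∀ {p q} → Compatible p q → NoCommonEdge p q
compatible⇒noCommonEdge pq common =
  let e , e∈p , e∈q = find common in disjoint pq e∈p e∈q
  where
  disjoint : ∀ {p q e} → Compatible p q → e ∈ones p → e ∈ones q → ⊥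
  disjoint []         () _
  disjoint (x≢y ∷ pq) e∈p e∈q with ∈ones-∷⁻ e∈p | ∈ones-∷⁻ e∈q
  ... | inj₁ refl          | inj₁ refl          = x≢y refl
  ... | inj₁ refl          | inj₂ (_ , _ , ())
  ... | inj₂ (_ , _ , ())  | inj₁ refl
  ... | inj₂ (f , f∈ , refl) | inj₂ (g , g∈ , refl) = disjoint pq f∈ g∈

-- The lengths matter because an empty list shares no edge with any list, yet is compatible only
-- with itself.
noCommonEdge⇒compatible : ∀ {p q} → length p ≡ length q → NoCommonEdge p q → Compatible p q
noCommonEdge⇒compatible {[]}    {[]}    _ _    = []
noCommonEdge⇒compatible {x ∷ p} {y ∷ q} l free =
  (λ { refl → free (lose (∈ones-zero {x} {p}) ∈ones-zero) }) ∷
  noCommonEdge⇒compatible (suc-injective l) λ common →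
    let e , e∈p , e∈q = find common in free (lose (∈ones-suc e∈p) (∈ones-suc e∈q))

-- Paths and cycles

adjacent⇒joined : ∀ {ps u v} → Adjacent ps u v → Joined (edges ps) u v
adjacent⇒joined (row-col e∈) = lose e∈ (inj₁ (refl , refl))
adjacent⇒joined (col-row e∈) = lose e∈ (inj₂ (refl , refl))

joined⇒adjacent : ∀ {ps u v} → Joined (edges ps) u v → Adjacent ps u v
joined⇒adjacent joined with find joined
... | e , e∈ , inj₁ (refl , refl) = row-col e∈
... | e , e∈ , inj₂ (refl , refl) = col-row e∈

module _ {es : EdgeList} {vs : List Vertex} where

  -- The last component expresses that p ends in s without naming the end: any neighbour of s may be
  -- appended. Appending the head of p itself closes the cycle.
  simplePaths-sound : ∀ {s} n {p} → p ∈ simplePaths es vs s n →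
    length p ≡ suc n × Unique p × (∀ {w} → Joined es s w → Linked (Joined es) (p ++ [ w ]))
  simplePaths-sound zero    (here refl) = refl , [] ∷ [] , λ sw → sw ∷ [-]
  simplePaths-sound (suc n) p∈
    with p , p∈′ , v∷p∈ ← find (∈-concatMap⁻ (λ p → map (_∷ p) (filter (extends? es p) vs))
                                        {xs = simplePaths es vs _ n} p∈)
    with v , v∈ , refl ← ∈-map⁻ (_∷ p) v∷p∈
    with _ , v~p , v∉p ← ∈-filter⁻ (extends? es p) {xs = vs} v∈
    with l , !p , closed ← simplePaths-sound n p∈′ =
    cong suc l , Allₚ.¬Any⇒All¬ p v∉p ∷ !p , λ sw → prepend p v~p (closed sw)
    where
    prepend : ∀ {v w} p → HeadJoined es v p → Linked (Joined es) (p ++ [ w ]) →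
              Linked (Joined es) (v ∷ p ++ [ w ])
    prepend (u ∷ p) vu linked = vu ∷ linked

  -- Paths grow at the head, so the start s is the last vertex of the given list and emerges only at
  -- the bottom of the recursion. For a cycle, w is its first vertex and `Joined es s w` is the
  -- closing edge.
  simplePaths-complete : ∀ v p {w} → Unique (v ∷ p) → Linked (Joined es) (v ∷ p ++ [ w ]) →
    All (_∈ vs) (v ∷ p) →
    ∃[ s ] s ∈ vs × Joined es s w × v ∷ p ∈ simplePaths es vs s (length p)
  simplePaths-complete v []      _            (vw ∷ _)      (v∈ ∷ _)  = v , v∈ , vw , here refl
  simplePaths-complete v (u ∷ p) (v∉ ∷ !p) (vu ∷ linked) (v∈ ∷ p⊆)
    with s , s∈ , sw , p∈ ← simplePaths-complete u p !p linked p⊆ =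
    s , s∈ , sw , ∈-concatMap⁺ _ (lose p∈ (∈-map⁺ (_∷ u ∷ p)
      (∈-filter⁺ (extends? es (u ∷ p)) v∈ (vu , Allₚ.All¬⇒¬Any v∉))))

hasCycle-sound : ∀ {ps vs l} → HasCycle (edges ps) vs l → ∃[ c ] IsCycle ps c × length c ≡ l
hasCycle-sound {ps} {vs} {suc l} (2<l , closes) with find closes
... | s , _ , closes′ with find closes′
... | []    , _  , ()
... | v ∷ p , p∈ , sv with simplePaths-sound l p∈
... | len , !p , closed =
  v ∷ p , (subst (3 ≤_) (sym len) 2<l , !p , Linked.map joined⇒adjacent (closed sv)) , len

hasCycle-complete : ∀ {ps vs c} → IsCycle ps c → All (_∈ vs) c → HasCycle (edges ps) vs (length c)
hasCycle-complete {c = v ∷ p} (3≤l , !c , linked) c⊆ =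
  let s , s∈ , sv , p∈ = simplePaths-complete v p !c (Linked.map adjacent⇒joined linked) c⊆
  in 3≤l , lose s∈ (lose p∈ sv)

∈ones⇒bounded : ∀ {m p i x} → Perm m p → (i , x) ∈ones p → i < m × x < m
∈ones⇒bounded {m} {p} perm e∈ =
  let i< , x∈ = locate p e∈
  in subst (_ <_) (trans (↭-length perm) (length-upTo m)) i< , ∈-upTo⁻ (∈-resp-↭ perm x∈)
  where
  locate : ∀ {i x} p → (i , x) ∈ones p → i < length p × x ∈ p
  locate []      ()
  locate (y ∷ p) e∈ with ∈ones-∷⁻ e∈
  ... | inj₁ refl           = s≤s z≤n , here refl
  ... | inj₂ (f , f∈ , refl) = let i< , x∈ = locate p f∈ in s≤s i< , there x∈

edges⇒bounded : ∀ {m ps i x} → All (Perm m) ps → (i , x) ∈ edges ps → i < m × x < m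
edges⇒bounded {ps = ps} perms e∈ with find (∈-concatMap⁻ ones e∈)
... | p , p∈ , e∈p = ∈ones⇒bounded (All.lookup perms p∈) e∈p

row∈vertices : ∀ {m i} → i < m → row i ∈ vertices m
row∈vertices i<m = ∈-++⁺ˡ (∈-map⁺ (true ,_) (∈-upTo⁺ i<m))

col∈vertices : ∀ {m i} → i < m → col i ∈ vertices m
col∈vertices {m} i<m = ∈-++⁺ʳ (map (true ,_) (upTo m)) (∈-map⁺ (false ,_) (∈-upTo⁺ i<m))

-- Every vertex of the cycle is the source of a step, the last one because the first is appended
-- again, and a source is an end of an edge, whose indices are below m.
cycle⊆vertices : ∀ {m ps c} → All (Perm m) ps → IsCycle ps c → All (_∈ vertices m) c
cycle⊆vertices {m} {ps} {v ∷ p} perms (_ , _ , linked) = sources (v ∷ p) linked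
  where
  source : ∀ {u w} → Adjacent ps u w → u ∈ vertices m
  source (row-col e∈) = row∈vertices (proj₁ (edges⇒bounded perms e∈))
  source (col-row e∈) = col∈vertices (proj₂ (edges⇒bounded perms e∈))
  sources : ∀ xs {w} → Linked (Adjacent ps) (xs ++ [ w ]) → All (_∈ vertices m) xs
  sources []           _             = []
  sources (x ∷ [])     (xw ∷ _)      = source xw ∷ []
  sources (x ∷ y ∷ xs) (xy ∷ linked) = source xy ∷ sources (y ∷ xs) linked

cycle-unique : ∀ {ps c} → IsCycle ps c → Unique c
cycle-unique {c = _ ∷ _} (_ , !c , _) = !c

length-cycle≤ : ∀ {m ps c} → All (Perm m) ps → IsCycle ps c → length c ≤ 2 * m
length-cycle≤ {m} perms cyc = subst (_ ≤_) (length-vertices m)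
  (unique-⊆⇒length≤ (cycle-unique cyc) (cycle⊆vertices perms cyc))

-- A shortest cycle has at most 2m vertices, so the search below 2m + 1 meets its length and the
-- default value does not arise. A shorter hit would be the length of a cycle below the minimum.
girth-correct : ∀ {m ps g} → All (Perm m) ps → Girth ps g → girth m (edges ps) ≡ g
girth-correct {m} {ps} {g} perms ((c , cyc , refl) , minimal)
  with least (hasCycle? (edges ps) (vertices m)) (2 * m + 1) in e
... | nothing = contradiction (hasCycle-complete cyc (cycle⊆vertices perms cyc))
  (least-nothing (hasCycle? (edges ps) (vertices m)) (2 * m + 1) e
    (≤-trans (s≤s (length-cycle≤ perms cyc)) (≤-reflexive (+-comm 1 (2 * m)))))
... | just l with least-just (hasCycle? (edges ps) (vertices m)) (2 * m + 1) e
...   | _ , cycle , shorter with <-cmp (length c) l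
...     | tri< c<l _ _ = contradiction (hasCycle-complete cyc (cycle⊆vertices perms cyc)) (shorter c<l)
...     | tri≈ _ c≡l _ = sym c≡l
...     | tri> _ _ l<c = let c′ , cyc′ , l≡ = hasCycle-sound cycle in
  contradiction (subst (length c ≤_) l≡ (minimal c′ cyc′)) (<⇒≱ l<c)

-- Block permutations and cyclic shifts

upTo-+ : ∀ a b → upTo (a + b) ≡ upTo a ++ map (a +_) (upTo b)
upTo-+ a zero    = trans (cong upTo (+-identityʳ a)) (sym (++-identityʳ (upTo a)))
upTo-+ a (suc b) = begin
  upTo (a + suc b)                         ≡⟨ cong upTo (+-suc a b) ⟩
  upTo (suc (a + b))                       ≡⟨ upTo-∷ʳ (a + b) ⟨
  upTo (a + b) ∷ʳ (a + b)                  ≡⟨ cong (_∷ʳ (a + b)) (upTo-+ a b) ⟩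
  (upTo a ++ map (a +_) (upTo b)) ∷ʳ (a + b) ≡⟨ ++-assoc (upTo a) _ _ ⟩
  upTo a ++ (map (a +_) (upTo b) ∷ʳ (a + b)) ≡⟨ cong (upTo a ++_) (map-++ (a +_) (upTo b) [ b ]) ⟨
  upTo a ++ map (a +_) (upTo b ∷ʳ b)       ≡⟨ cong (λ xs → upTo a ++ map (a +_) xs) (upTo-∷ʳ b) ⟩
  upTo a ++ map (a +_) (upTo (suc b))      ∎
  where open ≡-Reasoning

take-length-++ : ∀ {A : Set} (xs ys : List A) → take (length xs) (xs ++ ys) ≡ xs
take-length-++ []       ys = refl
take-length-++ (x ∷ xs) ys = cong (x ∷_) (take-length-++ xs ys)

drop-length-++ : ∀ {A : Set} (xs ys : List A) → drop (length xs) (xs ++ ys) ≡ ys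
drop-length-++ []       ys = refl
drop-length-++ (x ∷ xs) ys = drop-length-++ xs ys

-- Cutting `upTo m` at `m ∸ j` leaves `upTo j` translated by `m ∸ j`; for this `m ∸ j + j` has to be
-- m, whence the hypothesis.
cyclicShift≡C : ∀ {m j} → j ≤ m → cyclicShift m j ≡ C m j
cyclicShift≡C {m} {j} j≤m =
  sym (cong₂ _++_ (split drop (drop-length-++ (upTo a))) (split take (take-length-++ (upTo a))))
  where
  a = m ∸ j
  split : (f : ℕ → List ℕ → List ℕ) {r : List ℕ → List ℕ} →
          (∀ ys → f (length (upTo a)) (upTo a ++ ys) ≡ r ys) →
          f a (upTo m) ≡ r (map (a +_) (upTo j))
  split f h = trans (cong₂ f (sym (length-upTo a)) (trans (cong upTo (sym (m∸n+n≡m j≤m))) (upTo-+ a j)))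
                    (h (map (a +_) (upTo j)))

C-perm : ∀ m j → Perm m (C m j)
C-perm m j = ↭-trans (Permₚ.++-comm (drop (m ∸ j) (upTo m)) (take (m ∸ j) (upTo m)))
                     (↭-reflexive (take++drop≡id (m ∸ j) (upTo m)))

perm-length : ∀ {m p} → Perm m p → length p ≡ m
perm-length {m} p = trans (↭-length p) (length-upTo m)

upTo-* : ∀ c n → concatMap (λ t → map (t * n +_) (upTo n)) (upTo c) ≡ upTo (c * n)
upTo-* zero    n = refl
upTo-* (suc c) n = begin
  concatMap f (upTo (suc c))      ≡⟨ cong (concatMap f) (upTo-∷ʳ c) ⟨
  concatMap f (upTo c ∷ʳ c)       ≡⟨ concatMap-++ f (upTo c) [ c ] ⟩
  concatMap f (upTo c) ++ f c ++ [] ≡⟨ cong₂ _++_ (upTo-* c n) (++-identityʳ (f c)) ⟩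
  upTo (c * n) ++ f c             ≡⟨ upTo-+ (c * n) n ⟨
  upTo (c * n + n)                ≡⟨ cong upTo (+-comm (c * n) n) ⟩
  upTo (n + c * n)                ∎
  where
  open ≡-Reasoning
  f : ℕ → List ℕ
  f t = map (t * n +_) (upTo n)

concatMap-↭ : ∀ {A B : Set} {f g : A → List B} → (∀ x → f x ↭ g x) → ∀ xs → concatMap f xs ↭ concatMap g xs
concatMap-↭ f↭g []       = ↭-refl
concatMap-↭ f↭g (x ∷ xs) = Permₚ.++⁺ (f↭g x) (concatMap-↭ f↭g xs)

blocks-perm : ∀ c {n q} → Perm n q → Perm (c * n) (blocks c n q)
blocks-perm c {n} q↭ =
  ↭-trans (concatMap-↭ (λ t → Permₚ.map⁺ (t * n +_) q↭) (upTo c)) (↭-reflexive (upTo-* c n))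

-- The program is given the block size as a number, whereas `_∗_` reads it off the list.
blocks≡∗ : ∀ c {n q} → length q ≡ n → blocks c n q ≡ c ∗ q
blocks≡∗ c refl = refl

edges₂ : ∀ p q → ones p ++ ones q ≡ edges (p ∷ q ∷ [])
edges₂ p q = cong (ones p ++_) (sym (++-identityʳ (ones q)))

cycle-↭vertices : ∀ {m ps c} → All (Perm m) ps → IsCycle ps c → length c ≡ 2 * m → c ↭ vertices m
cycle-↭vertices {m} perms cyc l = unique-⊆-length⇒↭ (cycle-unique cyc) (cycle⊆vertices perms cyc)
  (trans l (sym (length-vertices m)))

-- A cycle with 2n distinct vertices among the 2n available visits them all, so its length alone
-- shows that it is the whole partition.
full⇒partition : ∀ {n q} → Perm n q → Full n q → PartitionBetween n q (I n) [ n ]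
full⇒partition {n} {q} q↭ (disjoint , cycle)
  with c , cyc , l ← hasCycle-sound (subst (λ es → HasCycle es (vertices n) (2 * n)) (edges₂ q (upTo n)) cycle) =
  (refl , perms , (noCommonEdge⇒compatible (trans (perm-length q↭) (sym (length-upTo n))) disjoint ∷ []) ∷ [] ∷ []) ,
  [ c ] , cyc ∷ [] , ↭-trans (↭-reflexive (++-identityʳ c)) (cycle-↭vertices perms cyc l) ,
  ↭-reflexive (cong [_] l)
  where
  perms : All (Perm n) (q ∷ I n ∷ [])
  perms = q↭ ∷ ↭-refl ∷ []

partition⇒full : ∀ {n q} → PartitionBetween n q (I n) [ n ] → Full n q
partition⇒full {n} {q} ((_ , perms , (compatible ∷ []) ∷ _) , cs , cycles , cover , lengths)
  with cs | cycles | ↭-singleton-inv lengths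
-- The cycle lengths are a rearrangement of the single entry 2n, so there is exactly one cycle.
... | c ∷ [] | cyc ∷ [] | l =
  compatible⇒noCommonEdge compatible ,
  subst₂ (λ es → HasCycle es (vertices n)) (sym (edges₂ q (upTo n))) (∷-injectiveˡ l)
    (hasCycle-complete cyc (cycle⊆vertices perms cyc))

module _ {m b k j : ℕ} (m≡ : m ≡ k * (b * k)) (j≤m : j ≤ m) where

  ∗-perm : ∀ {q} → Perm (b * k) q → Perm m (k ∗ q)
  ∗-perm {q} q↭ = subst₂ Perm (sym m≡) (blocks≡∗ k (perm-length q↭)) (blocks-perm k q↭)

  enumerated⇒candidate : ∀ {q} → Enumerated m b k j q → k ∗ q ∈ candidates m b k j
  enumerated⇒candidate {q} E with Enumerated.btu E
  ... | _ , _ , (c₁₂ ∷ c₁₃ ∷ []) ∷ (c₂₃ ∷ []) ∷ _ =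
    ∈-filter⁺ (λ p → disjoint₃? p (upTo m) (cyclicShift m j))
      (subst (_∈ _) (blocks≡∗ k (perm-length perm))
        (∈-map⁺ (blocks k (b * k)) (∈-filter⁺ (full? (b * k)) (permutations-complete (b * k) perm)
                                     (partition⇒full partition))))
      (compatible⇒noCommonEdge c₁₂ ,
       subst (NoCommonEdge (k ∗ q)) (sym shift≡) (compatible⇒noCommonEdge c₁₃) ,
       subst (NoCommonEdge (upTo m)) (sym shift≡) (compatible⇒noCommonEdge c₂₃))
    where
    open Enumerated E
    shift≡ = cyclicShift≡C j≤m

  candidate⇒enumerated : ∀ {p} → p ∈ candidates m b k j → ∃[ q ] Enumerated m b k j q × p ≡ k ∗ q
  candidate⇒enumerated p∈
    with p∈′ , d₁₂ , d₁₃ , d₂₃ ← ∈-filter⁻ (λ p → disjoint₃? p (upTo m) (cyclicShift m j)) p∈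
    with q , q∈ , refl ← ∈-map⁻ (blocks k (b * k)) p∈′
    with q∈′ , full ← ∈-filter⁻ (full? (b * k)) {xs = permutations (b * k)} q∈ =
    q , record
      { perm      = q↭
      ; partition = full⇒partition q↭ full
      ; btu       = refl , p₁-perm ∷ ↭-refl ∷ C-perm m j ∷ [] ,
          (compat p₁-perm ↭-refl (subst (λ p → NoCommonEdge p (upTo m)) p≡ d₁₂) ∷
           compat p₁-perm (C-perm m j) (subst₂ NoCommonEdge p≡ shift≡ d₁₃) ∷ []) ∷
          (compat ↭-refl (C-perm m j) (subst (NoCommonEdge (upTo m)) shift≡ d₂₃) ∷ []) ∷ [] ∷ []
      } , p≡
    where
    q↭ = permutations-sound (b * k) q∈′
    p≡ = blocks≡∗ k (perm-length q↭)
    shift≡ = cyclicShift≡C j≤m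
    p₁-perm = ∗-perm q↭
    compat : ∀ {p q} → Perm m p → Perm m q → NoCommonEdge p q → Compatible p q
    compat p↭ q↭ = noCommonEdge⇒compatible (trans (perm-length p↭) (sym (perm-length q↭)))

-- Selection of a largest score

best-nothing : ∀ {A : Set} (xs : List (ℕ × A)) → best xs ≡ nothing → xs ≡ []
best-nothing []       _ = refl
best-nothing (x ∷ xs) e with best xs
best-nothing (x ∷ xs) () | nothing
... | just y with proj₁ y <ᵇ proj₁ x
best-nothing (x ∷ xs) () | just y | true
best-nothing (x ∷ xs) () | just y | false

best-just : ∀ {A : Set} (xs : List (ℕ × A)) {y} → best xs ≡ just y →
            y ∈ xs × All (λ x → proj₁ x ≤ proj₁ y) xs
best-just (x ∷ xs) e with best xs in e′
best-just (x ∷ xs) refl | nothing with refl ← best-nothing xs e′ = here refl , ≤-refl ∷ []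
... | just y with best-just xs e′ | proj₁ y <ᵇ proj₁ x | <ᵇ-reflects-< (proj₁ y) (proj₁ x)
best-just (x ∷ xs) refl | just y | y∈ , ≤y | true | ofʸ y<x =
  here refl , ≤-refl ∷ All.map (λ ≤y → ≤-trans ≤y (<⇒≤ y<x)) ≤y
best-just (x ∷ xs) refl | just y | y∈ , ≤y | false | ofⁿ y≮x = there y∈ , ≮⇒≥ y≮x ∷ ≤y

-- Translated cycles in block permutations

∈ones-++ʳ : ∀ as {i x q} → (i , x) ∈ones q → (length as + i , x) ∈ones (as ++ q)
∈ones-++ʳ []       e∈ = e∈
∈ones-++ʳ (a ∷ as) e∈ = ∈ones-suc (∈ones-++ʳ as e∈)

∈ones-++ˡ : ∀ q {i x bs} → (i , x) ∈ones q → (i , x) ∈ones (q ++ bs)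
∈ones-++ˡ []      ()
∈ones-++ˡ (y ∷ q) e∈ with ∈ones-∷⁻ e∈
... | inj₁ refl            = ∈ones-zero
... | inj₂ (_ , f∈ , refl) = ∈ones-suc (∈ones-++ˡ q f∈)

∈ones-map : ∀ f q {i x} → (i , x) ∈ones q → (i , f x) ∈ones (map f q)
∈ones-map f []      ()
∈ones-map f (y ∷ q) e∈ with ∈ones-∷⁻ e∈
... | inj₁ refl            = ∈ones-zero
... | inj₂ (_ , f∈ , refl) = ∈ones-suc (∈ones-map f q f∈)

length-blocks : ∀ c {n q} → length q ≡ n → length (blocks c n q) ≡ c * n
length-blocks c {q = q} refl = go (upTo c) (length-upTo c)
  where
  go : ∀ xs {l} → length xs ≡ l → length (concatMap (λ t → map (t * length q +_) q) xs) ≡ l * length q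
  go []       refl = refl
  go (x ∷ xs) refl = trans (length-++ (map (x * length q +_) q)) (cong₂ _+_ (length-map _ q) (go xs refl))

-- The list of blocks is cut around block t: the t blocks before it have total length t * n, which
-- is the row offset, and the r blocks after it do not affect the position.
∈ones-blocks : ∀ {c n q t i x} → length q ≡ n → t < c → (i , x) ∈ones q →
               (t * n + i , t * n + x) ∈ones (blocks c n q)
∈ones-blocks {c} {n} {q} {t} {i} {x} l t<c e∈ =
  subst₂ (λ a p → (a + i , t * n + x) ∈ones p) (length-blocks t l) (sym split)
    (∈ones-++ʳ (blocks t n q) (∈ones-++ˡ (g t) (∈ones-map (t * n +_) q e∈)))
  where
  g : ℕ → List ℕ
  g t = map (t * n +_) q
  r = c ∸ suc t
  c≡ : c ≡ t + suc r
  c≡ = trans (sym (m+[n∸m]≡n t<c)) (sym (+-suc t r))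
  rest = concatMap g (map (t +_) (applyUpTo suc r))
  split : blocks c n q ≡ blocks t n q ++ g t ++ rest
  split = begin
    concatMap g (upTo c)                          ≡⟨ cong (concatMap g ∘ upTo) c≡ ⟩
    concatMap g (upTo (t + suc r))                ≡⟨ cong (concatMap g) (upTo-+ t (suc r)) ⟩
    concatMap g (upTo t ++ map (t +_) (upTo (suc r))) ≡⟨ concatMap-++ g (upTo t) _ ⟩
    concatMap g (upTo t) ++ g (t + 0) ++ rest     ≡⟨ cong (λ s → concatMap g (upTo t) ++ g s ++ rest) (+-identityʳ t) ⟩
    concatMap g (upTo t) ++ g t ++ rest           ∎
    where open ≡-Reasoning

∈edges₂⁻ : ∀ {p q e} → e ∈ edges (p ∷ q ∷ []) → e ∈ones p ⊎ e ∈ones q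
∈edges₂⁻ {p} {q} e∈ = ∈-++⁻ (ones p) (subst (_ ∈_) (sym (edges₂ p q)) e∈)

∈edges₂⁺ : ∀ {p q e} → e ∈ones p ⊎ e ∈ones q → e ∈ edges (p ∷ q ∷ [])
∈edges₂⁺ {p} {q} (inj₁ e∈) = ∈-++⁺ˡ e∈
∈edges₂⁺ {p} {q} (inj₂ e∈) = ∈-++⁺ʳ (ones p) (∈-++⁺ˡ e∈)

concatMap-++-↭ : ∀ {A B : Set} (f g : A → List B) xs →
                 concatMap (λ x → f x ++ g x) xs ↭ concatMap f xs ++ concatMap g xs
concatMap-++-↭ f g []       = ↭-refl
concatMap-++-↭ f g (x ∷ xs) =
  ↭-trans (↭-reflexive (++-assoc (f x) (g x) _))
  (↭-trans (Permₚ.++⁺ˡ (f x) (↭-trans (Permₚ.++⁺ˡ (g x) (concatMap-++-↭ f g xs))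
                                      (Permₚ.shifts (g x) (concatMap f xs))))
           (↭-reflexive (sym (++-assoc (f x) (concatMap f xs) _))))

translate : ℕ → Vertex → Vertex
translate s (b , i) = b , s + i

translate-injective : ∀ s {u v} → translate s u ≡ translate s v → u ≡ v
translate-injective s {b , i} {c , j} e =
  cong₂ _,_ (cong proj₁ e) (+-cancelˡ-≡ s i j (cong proj₂ e))

cycle-map : ∀ {ps qs c} (f : Vertex → Vertex) → (∀ {u v} → f u ≡ f v → u ≡ v) →
            (∀ {u v} → Adjacent ps u v → Adjacent qs (f u) (f v)) →
            IsCycle ps c → IsCycle qs (map f c)
cycle-map {qs = qs} {v ∷ c} f injective preserves (3≤l , !c , linked) =
  subst (3 ≤_) (cong suc (sym (length-map f c))) 3≤l ,
  Uniqueₚ.map⁺ injective !c ,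
  subst (Linked (Adjacent qs)) (map-++ f (v ∷ c) [ v ]) (Linkedₚ.map⁺ (Linked.map preserves linked))

-- Each translate lists its own rows and then its own columns, while `vertices (k * n)` lists all
-- rows first. So the pieces are regrouped by side, and `upTo-*` reassembles the range on each side.
concatMap-translate-vertices : ∀ k n →
  concatMap (λ t → map (translate (t * n)) (vertices n)) (upTo k) ↭ vertices (k * n)
concatMap-translate-vertices k n =
  ↭-trans (↭-reflexive (concatMap-cong split (upTo k)))
  (↭-trans (concatMap-++-↭ (side true) (side false) (upTo k))
           (↭-reflexive (cong₂ _++_ (sides true) (sides false))))
  where
  side : Bool → ℕ → List Vertex
  side b t = map (b ,_) (map (t * n +_) (upTo n))
  translate-side : ∀ b t → map (translate (t * n)) (map (b ,_) (upTo n)) ≡ side b t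
  translate-side b t = trans (sym (map-∘ (upTo n))) (map-∘ (upTo n))
  split : ∀ t → map (translate (t * n)) (vertices n) ≡ side true t ++ side false t
  split t = trans (map-++ (translate (t * n)) (map (true ,_) (upTo n)) _)
                  (cong₂ _++_ (translate-side true t) (translate-side false t))
  sides : ∀ b → concatMap (side b) (upTo k) ≡ map (b ,_) (upTo (k * n))
  sides b = trans (sym (map-concatMap (b ,_) (λ t → map (t * n +_) (upTo n)) (upTo k)))
                  (cong (map (b ,_)) (upTo-* k n))

map-constant : ∀ {A B : Set} (f : A → B) {y} → (∀ x → f x ≡ y) → ∀ xs → map f xs ≡ replicate (length xs) y
map-constant f f≡ []       = refl
map-constant f f≡ (x ∷ xs) = cong₂ _∷_ (f≡ x) (map-constant f f≡ xs)

block-partition : ∀ {m n q} k → m ≡ k * n → Perm n q → PartitionBetween n q (I n) [ n ] →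
                  FormBTU m 2 (k ∗ q ∷ I m ∷ []) →
                  PartitionBetween m (k ∗ q) (I m) (replicate k n)
block-partition {n = n} {q} k refl q↭ ((_ , perms , _) , cs , cycles , _ , lengths) btu
  with cs | cycles | ↭-singleton-inv lengths
... | c ∷ [] | cyc ∷ [] | l =
  btu , map copy (upTo k) , Allₚ.map⁺ (Allₚ.applyUpTo⁺₁ id k copy-cycle) ,
  ↭-trans (concatMap-↭ (λ t → Permₚ.map⁺ (translate (t * n)) c↭) (upTo k))
          (concatMap-translate-vertices k n) ,
  ↭-reflexive lengths≡
  where
  copy : ℕ → List Vertex
  copy t = map (translate (t * n)) c
  c↭ : c ↭ vertices n
  c↭ = cycle-↭vertices perms cyc (∷-injectiveˡ l)
  translate-edge : ∀ {t i x} → t < k → (i , x) ∈ edges (q ∷ I n ∷ []) →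
                   (t * n + i , t * n + x) ∈ edges (k ∗ q ∷ I (k * n) ∷ [])
  translate-edge {t} {i} {x} t<k e∈ = ∈edges₂⁺ (Sum.map
    (subst ((t * n + i , t * n + x) ∈ones_) (blocks≡∗ k (perm-length q↭)) ∘ ∈ones-blocks {k} (perm-length q↭) t<k)
    -- The identity is itself the block permutation `k ∗ I n`, so the same argument moves its edges.
    (subst ((t * n + i , t * n + x) ∈ones_) (upTo-* k n) ∘ ∈ones-blocks {k} (length-upTo n) t<k)
    (∈edges₂⁻ {q} e∈))
  copy-cycle : ∀ {t} → t < k → IsCycle (k ∗ q ∷ I (k * n) ∷ []) (copy t)
  copy-cycle {t} t<k = cycle-map (translate (t * n)) (translate-injective (t * n))
    (λ { (row-col e∈) → row-col (translate-edge t<k e∈)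
       ; (col-row e∈) → col-row (translate-edge t<k e∈) }) cyc
  length-copy : ∀ t → length (copy t) ≡ 2 * n
  length-copy t = trans (length-map _ c) (∷-injectiveˡ l)
  lengths≡ : map length (map copy (upTo k)) ≡ map (2 *_) (replicate k n)
  lengths≡ = begin
    map length (map copy (upTo k))        ≡⟨ map-∘ (upTo k) ⟨
    map (length ∘ copy) (upTo k)          ≡⟨ map-constant (length ∘ copy) length-copy (upTo k) ⟩
    replicate (length (upTo k)) (2 * n)   ≡⟨ cong (λ l → replicate l (2 * n)) (length-upTo k) ⟩
    replicate k (2 * n)                   ≡⟨ map-replicate (2 *_) k n ⟨
    map (2 *_) (replicate k n)            ∎
    where open ≡-Reasoning

-- The Hamiltonian cycle of I and C_j

walk : List ℕ → List Vertex
walk []       = []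
walk (x ∷ xs) = row x ∷ col x ∷ walk xs

walk-↭ : ∀ xs → walk xs ↭ map (true ,_) xs ++ map (false ,_) xs
walk-↭ []       = ↭-refl
walk-↭ (x ∷ xs) = ↭-prep (row x)
  (↭-trans (↭-prep (col x) (walk-↭ xs)) (↭-sym (shift (col x) (map (true ,_) xs) (map (false ,_) xs))))

length-walk : ∀ xs → length (walk xs) ≡ 2 * length xs
length-walk []       = refl
length-walk (x ∷ xs) = trans (cong (suc ∘ suc) (length-walk xs)) (sym (*-suc 2 (length xs)))

walk-unique : ∀ {xs} → Unique xs → Unique (walk xs)
walk-unique {xs} !xs = Permₛ.Unique-resp-↭ (setoid Vertex) (↭⇒↭ₛ (↭-sym (walk-↭ xs)))
  (Uniqueₚ.++⁺ (Uniqueₚ.map⁺ (cong proj₂) !xs) (Uniqueₚ.map⁺ (cong proj₂) !xs)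
    λ (r∈ , c∈) → different (∈-map⁻ (true ,_) r∈) (∈-map⁻ (false ,_) c∈))
  where
  different : ∀ {v : Vertex} → ∃[ i ] i ∈ xs × v ≡ row i → ∃[ i ] i ∈ xs × v ≡ col i → ⊥
  different (_ , _ , refl) (_ , _ , ())

walk-linked : ∀ {ps} xs {y} → All (λ x → Adjacent ps (row x) (col x)) xs →
              Linked (λ x y → Adjacent ps (col x) (row y)) (xs ++ [ y ]) →
              Linked (Adjacent ps) (walk xs ++ [ row y ])
walk-linked []           _         _             = [-]
walk-linked (x ∷ [])     (rc ∷ _)  (cr ∷ _)      = rc ∷ cr ∷ [-]
walk-linked (x ∷ y ∷ xs) (rc ∷ rcs) (cr ∷ linked) = rc ∷ cr ∷ walk-linked (y ∷ xs) rcs linked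

∈ones-I : ∀ {m i} → i < m → (i , i) ∈ones (I m)
∈ones-I {m} {i} i<m = subst₂ (λ n p → (n , n) ∈ones p) (+-identityʳ i)
  (trans (sym (upTo-+ i (suc r))) (cong upTo (trans (+-suc i r) (m+[n∸m]≡n i<m))))
  (subst (λ l → (l + 0 , i + 0) ∈ones (upTo i ++ map (i +_) (upTo (suc r)))) (length-upTo i)
    (∈ones-++ʳ (upTo i) ∈ones-zero))
  where r = m ∸ suc i

-- Column x below m - j lies in the second part of the list, after j entries, hence in row x + j. A
-- later column lies in the first part, in row x - (m - j), which is x + j reduced by m.
∈ones-C : ∀ {m j x} .{{_ : NonZero m}} → j ≤ m → x < m → ((x + j) % m , x) ∈ones (C m j)
∈ones-C {m} {j} {x} j≤m x<m = subst (((x + j) % m , x) ∈ones_) (cyclicShift≡C j≤m) (case (<-≤-connex x a))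
  where
  a = m ∸ j
  top = map (a +_) (upTo j)
  case : x < a ⊎ a ≤ x → ((x + j) % m , x) ∈ones (top ++ upTo a)
  case (inj₁ x<a) = subst (λ r → (r , x) ∈ones (top ++ upTo a)) r≡ (∈ones-++ʳ top (∈ones-I x<a))
    where
    x+j<m : x + j < m
    x+j<m = subst (x + j <_) (m∸n+n≡m j≤m) (+-monoˡ-< j x<a)
    r≡ : length top + x ≡ (x + j) % m
    r≡ = trans (cong (_+ x) (trans (length-map _ (upTo j)) (length-upTo j)))
               (trans (+-comm j x) (sym (m<n⇒m%n≡m x+j<m)))
  case (inj₂ a≤x) = subst₂ (λ r x → (r , x) ∈ones (top ++ upTo a)) r≡ (m+[n∸m]≡n a≤x)
    (∈ones-++ˡ top (∈ones-map (a +_) (upTo j) (∈ones-I y<j)))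
    where
    y = x ∸ a
    x+j≡ : x + j ≡ y + m
    x+j≡ = begin
      x + j           ≡⟨ cong (_+ j) (m∸n+n≡m a≤x) ⟨
      y + a + j       ≡⟨ +-assoc y a j ⟩
      y + (a + j)     ≡⟨ cong (y +_) (m∸n+n≡m j≤m) ⟩
      y + m           ∎
      where open ≡-Reasoning
    y<j : y < j
    y<j = +-cancelʳ-< m y j (subst₂ _<_ x+j≡ (+-comm m j) (+-monoˡ-< j x<m))
    r≡ : y ≡ (x + j) % m
    r≡ = sym (trans (cong (_% m) x+j≡) (trans ([m+n]%n≡m%n y m) (m<n⇒m%n≡m (<-≤-trans y<j j≤m))))

-- Equal remainders would make m divide j (b - a), hence b - a by coprimality; but b - a is positive
-- and less than m.
multiples-distinct : ∀ {m j} .{{_ : NonZero m}} → Coprime j m → ∀ {a b} → a < b → b < m →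
                     (a * j) % m ≢ (b * j) % m
multiples-distinct {m} {j} coprime {a} {b} a<b b<m same =
  <⇒≱ (≤-<-trans (m∸n≤m b a) b<m) (∣⇒≤ {{>-nonZero (m<n⇒0<n∸m a<b)}} m∣b∸a)
  where
  open ≡-Reasoning
  difference : j * (b ∸ a) ≡ ((b * j) / m ∸ (a * j) / m) * m
  difference = begin
    j * (b ∸ a)                                  ≡⟨ *-comm j (b ∸ a) ⟩
    (b ∸ a) * j                                  ≡⟨ *-distribʳ-∸ j b a ⟩
    b * j ∸ a * j                                ≡⟨ cong₂ _∸_ (m≡m%n+[m/n]*n (b * j) m)
                                                              (trans (m≡m%n+[m/n]*n (a * j) m) (cong (_+ _) same)) ⟩
    ((b * j) % m + (b * j) / m * m) ∸ ((b * j) % m + (a * j) / m * m)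
                                                 ≡⟨ [m+n]∸[m+o]≡n∸o ((b * j) % m) _ _ ⟩
    (b * j) / m * m ∸ (a * j) / m * m            ≡⟨ *-distribʳ-∸ m ((b * j) / m) ((a * j) / m) ⟨
    ((b * j) / m ∸ (a * j) / m) * m              ∎
  m∣b∸a : m ∣ b ∸ a
  m∣b∸a = coprime-divisor (Coprimality.sym coprime) (divides ((b * j) / m ∸ (a * j) / m) difference)

-- The cycle is row 0, col 0, row j, col j, row 2j, … (mod m): column x of C_j
-- has its one in row x + j.
shift-partition : ∀ {m j} → 2 ≤ m → j ≤ m → Coprime j m → FormBTU m 2 (I m ∷ C m j ∷ []) →
                  PartitionBetween m (I m) (C m j) [ m ]
shift-partition {m@(suc _)} {j} 2≤m j≤m coprime btu =
  btu , [ walk rs ] , (3≤l , walk-unique !rs , linked) ∷ [] ,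
  ↭-trans (↭-reflexive (++-identityʳ (walk rs)))
    (↭-trans (walk-↭ rs) (Permₚ.++⁺ (Permₚ.map⁺ _ rs↭) (Permₚ.map⁺ _ rs↭))) ,
  ↭-reflexive (cong [_] l)
  where
  ps = I m ∷ C m j ∷ []
  r : ℕ → ℕ
  r t = (t * j) % m
  rs = applyUpTo r m
  !rs : Unique rs
  !rs = Uniqueₚ.applyUpTo⁺₁ r m (multiples-distinct coprime)
  rs↭ : rs ↭ upTo m
  rs↭ = unique-⊆-length⇒↭ !rs (Allₚ.applyUpTo⁺₂ r m (λ t → ∈-upTo⁺ (m%n<n (t * j) m)))
          (trans (length-applyUpTo r m) (sym (length-upTo m)))
  l : length (walk rs) ≡ 2 * m
  l = trans (length-walk rs) (cong (2 *_) (length-applyUpTo r m))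
  3≤l : 3 ≤ length (walk rs)
  3≤l = subst (3 ≤_) (sym l) (≤-trans (n≤1+n 3) (*-monoʳ-≤ 2 2≤m))
  advance : ∀ t → Adjacent ps (col (r t)) (row (r (suc t)))
  advance t = subst (λ y → Adjacent ps (col (r t)) (row y)) r+j≡
    (col-row (∈edges₂⁺ {I m} (inj₂ (∈ones-C j≤m (m%n<n (t * j) m)))))
    where
    r+j≡ : (r t + j) % m ≡ r (suc t)
    r+j≡ = begin
      (r t + j) % m               ≡⟨ %-distribˡ-+ (r t) j m ⟩
      (r t % m + j % m) % m       ≡⟨ cong (λ x → (x + j % m) % m) (m%n%n≡m%n (t * j) m) ⟩
      (r t + j % m) % m           ≡⟨ %-distribˡ-+ (t * j) j m ⟨
      (t * j + j) % m             ≡⟨ cong (_% m) (+-comm (t * j) j) ⟩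
      (suc t * j) % m             ∎
      where open ≡-Reasoning
  r[m]≡r[0] : r m ≡ r 0
  r[m]≡r[0] = trans (cong (_% m) (*-comm m j))
    (trans (m*n%n≡0 j m) (sym (m<n⇒m%n≡m {n = m} {m = 0} (s≤s z≤n))))
  linked : Linked (Adjacent ps) (walk rs ++ [ row (r 0) ])
  linked = subst (λ y → Linked (Adjacent ps) (walk rs ++ [ row y ])) r[m]≡r[0]
    (walk-linked rs
      (Allₚ.applyUpTo⁺₂ r m (λ t → row-col (∈edges₂⁺ {I m} (inj₁ (∈ones-I (m%n<n (t * j) m))))))
      (subst (Linked _) (sym (applyUpTo-∷ʳ r m)) (Linkedₚ.applyUpTo⁺₂ r (suc m) advance)))

-- Correctness of the plain algorithm

coprime′⇒coprime : ∀ {i n} → 0 < n → Coprime′ i n → Coprime i n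
coprime′⇒coprime {i} {n} 0<n ¬common {d} (d∣i , d∣n) with <-cmp 1 d
... | tri≈ _ 1≡d _ = sym 1≡d
... | tri< 1<d _ _ = contradiction (lose d∈ (1<d , d∣i , d∣n)) ¬common
  where
  d∈ : d ∈ upTo (n + 1)
  d∈ = ∈-upTo⁺ (subst (d <_) (+-comm 1 n) (s≤s (∣⇒≤ {{>-nonZero 0<n}} d∣n)))
-- Here d = 0, and 0 divides n only when n = 0.
... | tri> _ _ (s≤s z≤n) = contradiction (sym (0∣⇒≡0 d∣n)) (<⇒≢ 0<n)

coprime⇒coprime′ : ∀ {i n} → Coprime i n → Coprime′ i n
coprime⇒coprime′ coprime common with d , _ , 1<d , d∣i , d∣n ← find common =
  <⇒≢ 1<d (sym (coprime (d∣i , d∣n)))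

edges₃ : ∀ p q r → ones p ++ ones q ++ ones r ≡ edges (p ∷ q ∷ r ∷ [])
edges₃ p q r = cong (ones p ++_) (edges₂ q r)

square-cancel : ∀ {b k l} .{{_ : NonZero b}} → b * (k * k) ≡ b * (l * l) → k ≡ l
square-cancel {b} {k} {l} e with <-cmp k l | *-cancelˡ-≡ (k * k) (l * l) b e
... | tri< k<l _ _ | kk≡ll = contradiction kk≡ll (<⇒≢ (*-mono-< k<l k<l))
... | tri≈ _ k≡l _ | _     = k≡l
... | tri> _ _ l<k | kk≡ll = contradiction (sym kk≡ll) (<⇒≢ (*-mono-< l<k l<k))

module _ {m b k : ℕ} (A : Admissible m b k) where

  open Admissible A

  private
    m≡bkk : Square m b k
    m≡bkk = trans m≡bk² (cong (λ l → b * (k * l)) (*-identityʳ k))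

    m≡kbk : m ≡ k * (b * k)
    m≡kbk = trans m≡bkk (trans (sym (*-assoc b k k)) (*-comm (b * k) k))

    0<m : 0 < m
    0<m = <-trans (s≤s z≤n) 3<m/2

    0<b : 0 < b
    0<b = n≢0⇒n>0 λ { refl → <⇒≢ 0<m (sym m≡bk²) }

    instance
      b≢0 : NonZero b
      b≢0 = >-nonZero 0<b

      k≢0 : NonZero k
      k≢0 = >-nonZero (≤-trans (s≤s z≤n) 2≤k)

    b<m+1 : b < m + 1
    b<m+1 = subst (b <_) (+-comm 1 m) (s≤s (subst (b ≤_) (sym m≡bkk) (m≤m*n b (k * k) {{m*n≢0 k k}})))

    k<m+1 : k < m + 1
    k<m+1 = subst (k <_) (+-comm 1 m) (s≤s (subst (k ≤_) (sym m≡kbk) (m≤m*n k (b * k) {{m*n≢0 b k}})))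

    hasRoot? : ∀ b → Nullary.Dec (Any (Square m b) (upTo (m + 1)))
    hasRoot? b = any? (square? m b) (upTo (m + 1))

  -- The given b is among the values searched, since b and k are at most m, so the search finds
  -- nothing larger; `b-minimal` rules out anything smaller.
  least-b : least hasRoot? (m + 1) ≡ just b
  least-b with least-exists hasRoot? (m + 1) b<m+1 (lose (∈-upTo⁺ k<m+1) m≡bkk)
  ... | b′ , e with least-just hasRoot? (m + 1) e
  ... | _ , root , minimal with find root
  ... | k′ , _ , m≡b′k′k′ = trans e (cong just (≤-antisym
    (≮⇒≥ λ b<b′ → minimal b<b′ (lose (∈-upTo⁺ k<m+1) m≡bkk))
    (b-minimal b′ k′ (trans m≡b′k′k′ (cong (λ l → b′ * (k′ * l)) (sym (*-identityʳ k′)))))))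

  -- As b is positive, m = b k² determines k, and whatever the search finds is k.
  least-k : least (square? m b) (m + 1) ≡ just k
  least-k with least-exists (square? m b) (m + 1) k<m+1 m≡bkk
  ... | k′ , e with least-just (square? m b) (m + 1) e
  ... | _ , m≡bk′k′ , _ = trans e (cong just (square-cancel {b} (trans (sym m≡bk′k′) m≡bkk)))

  algorithm≡ : algorithm m ≡ maybe′ (searchResult m b k) nothing (least (shift? m (b * k)) m)
  algorithm≡ rewrite least-b | least-k = refl

  shift⇒valid : ∀ {j} → j < m → Shift m (b * k) j → ValidShift m b k j
  shift⇒valid j<m (coprime , n<j , n<m∸j) =
    (≤-trans (s≤s z≤n) n<j , j<m) , coprime′⇒coprime 0<m coprime , ⊓-glb n<m∸j n<j

  valid⇒shift : ∀ {j} → ValidShift m b k j → Shift m (b * k) j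
  valid⇒shift {j} (_ , coprime , n<) =
    coprime⇒coprime′ coprime , m≤n⊓o⇒m≤o (m ∸ j) j n< , m≤n⊓o⇒m≤n (m ∸ j) j n<

  enumerated⇒Z : ∀ {j q} → ValidShift m b k j → Enumerated m b k j q → Z[ m ,3] A (triple m k j q)
  enumerated⇒Z {j} {q} ((_ , j<m) , coprime , _) E with Enumerated.btu E
  ... | btu@(_ , p₁↭ ∷ p₂↭ ∷ p₃↭ ∷ [] , (c₁₂ ∷ _ ∷ []) ∷ (c₂₃ ∷ []) ∷ _) =
    btu , refl , (q , perm , refl) ,
    block-partition k m≡kbk perm partition (refl , p₁↭ ∷ p₂↭ ∷ [] , (c₁₂ ∷ []) ∷ [] ∷ []) ,
    shift-partition (≤-trans (s≤s (s≤s z≤n)) 3<m/2) (<⇒≤ j<m) coprime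
      (refl , p₂↭ ∷ p₃↭ ∷ [] , (c₂₃ ∷ []) ∷ [] ∷ [])
    where open Enumerated E using (perm; partition)

  score-girth : ∀ {j q g} → j < m → Enumerated m b k j q →
                Girth (listing (triple m k j q)) g → proj₁ (score m j (k ∗ q)) ≡ g
  score-girth {j} {q} j<m E G =
    trans (cong (girth m) (trans (edges₃ (k ∗ q) (upTo m) (cyclicShift m j))
                                 (cong (λ p → edges (k ∗ q ∷ I m ∷ p ∷ [])) (cyclicShift≡C (<⇒≤ j<m)))))
      (girth-correct (proj₁ (proj₂ (Enumerated.btu E))) G)

  searchResult-isOutput : ∀ {j} → ValidShift m b k j → IsOutput A (searchResult m b k j)
  searchResult-isOutput {j} valid@((_ , j<m) , _) with best (map (score m j) (candidates m b k j)) in e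
  ... | nothing = no-q₁ j valid λ q E →
    case-[] (best-nothing (map (score m j) (candidates m b k j)) e)
      (∈-map⁺ (score m j) (enumerated⇒candidate {b = b} {k} {j} m≡kbk (<⇒≤ j<m) E))
    where
    case-[] : ∀ {X : Set} {x : X} {xs} → xs ≡ [] → ¬ x ∈ xs
    case-[] refl ()
  ... | just y with best-just (map (score m j) (candidates m b k j)) e
  ... | y∈ , largest-score with ∈-map⁻ (score m j) y∈
  ... | p , p∈ , refl with candidate⇒enumerated {b = b} {k} {j} m≡kbk (<⇒≤ j<m) p∈
  ... | q , E , refl = subst (λ p₃ → IsOutput A (just (k ∗ q , I m , p₃))) (sym (cyclicShift≡C (<⇒≤ j<m)))
    (largest j q valid E
      (λ q′ g g′ E′ G G′ → subst₂ _≤_ (score-girth j<m E′ G′) (score-girth j<m E G)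
        (All.lookup largest-score (∈-map⁺ (score m j)
          (enumerated⇒candidate {b = b} {k} {j} m≡kbk (<⇒≤ j<m) E′))))
      (enumerated⇒Z valid E))

  algorithm-isOutput : IsOutput A (algorithm m)
  algorithm-isOutput rewrite algorithm≡ with least (shift? m (b * k)) m in e
  ... | nothing = no-shift λ j valid@((_ , j<m) , _) →
    least-nothing (shift? m (b * k)) m e j<m (valid⇒shift valid)
  ... | just j  = let j<m , shift , _ = least-just (shift? m (b * k)) m e in
    searchResult-isOutput (shift⇒valid j<m shift)

-- Evaluation and cost

-- Justifies that `dividesᵗ` tries quotients only up to y. For positive x the given quotient is at
-- most y; for x = 0 it can be anything and is replaced by 0.
bounded-quotient : ∀ {x y} → x ∣ y → ∃[ q ] q < y + 1 × q * x ≡ y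
bounded-quotient {zero}      {y} (divides q y≡) =
  0 , subst (0 <_) (+-comm 1 y) (s≤s z≤n) , trans (sym (*-zeroʳ q)) (sym y≡)
bounded-quotient {x@(suc _)} {y} (divides q y≡) =
  q , subst (q <_) (+-comm 1 y) (s≤s (subst (q ≤_) (sym y≡) (m≤m*n q x))) , sym y≡

length-insertions : ∀ x ys → length (insertions x ys) ≡ suc (length ys)
length-insertions x []       = refl
length-insertions x (y ∷ ys) = cong suc (trans (length-map (y ∷_) (insertions x ys)) (length-insertions x ys))

infixr 6 _⊞_
-- The exponent of a sum: two summands are at most twice the larger power of B, and the factor 2 is
-- absorbed by one more B.
_⊞_ : ℕ → ℕ → ℕ
a ⊞ b = 1 + (a ⊔ b)

^-distribʳ-* : ∀ n x y → (x * y) ^ n ≡ x ^ n * y ^ n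
^-distribʳ-* zero    x y = refl
^-distribʳ-* (suc n) x y =
  trans (cong (x * y *_) (^-distribʳ-* n x y)) ([m*n]*[o*p]≡[m*o]*[n*p] x y (x ^ n) (y ^ n))

square⇒b*k≤m : ∀ {m} b k → Square m b k → b * k ≤ m
square⇒b*k≤m b zero    refl = ≤-reflexive refl
square⇒b*k≤m b (suc k) refl = *-monoʳ-≤ b (m≤m*n (suc k) (suc k))

-- Sizes bounded by powers of B

module Bounds (B : ℕ) (2≤B : 2 ≤ B) where

  infix 4 _⊑_

  private
    instance
      B≢0 : NonZero B
      B≢0 = >-nonZero (<-trans (s≤s z≤n) 2≤B)

    variable
      α β : Ty
      a b e x y k : ℕ

  -- As a record type it determines `x` and `e`, so exponents can be inferred from the bounds that
  -- are combined.
  record _⊑_ (x e : ℕ) : Set where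
    constructor bounded
    field bound : x ≤ B ^ e
  open _⊑_ public

  ⊑-≤ : x ≤ y → y ⊑ e → x ⊑ e
  ⊑-≤ x≤y (bounded y≤) = bounded (≤-trans x≤y y≤)

  ⊑-mono : a ≤ b → x ⊑ a → x ⊑ b
  ⊑-mono a≤b (bounded x≤) = bounded (≤-trans x≤ (^-monoʳ-≤ B a≤b))

  power⊑ : ∀ e → B ^ e ⊑ e
  power⊑ e = bounded ≤-refl

  1⊑0 : 1 ⊑ 0
  1⊑0 = bounded ≤-refl

  0⊑0 : 0 ⊑ 0
  0⊑0 = bounded z≤n

  2⊑1 : 2 ⊑ 1
  2⊑1 = bounded (subst (2 ≤_) (sym (*-identityʳ B)) 2≤B)

  infixr 6 _⊕_
  infixr 7 _⊛_

  _⊛_ : x ⊑ a → y ⊑ b → x * y ⊑ a + b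
  _⊛_ {x} {a} {y} {b} (bounded p) (bounded q) =
    bounded (subst (x * y ≤_) (sym (^-distribˡ-+-* B a b)) (*-mono-≤ p q))

  _⊕_ : x ⊑ a → y ⊑ b → x + y ⊑ a ⊞ b
  _⊕_ {x} {a} {y} {b} p q = ⊑-≤ x+y≤2z (2⊑1 ⊛ bounded ≤-refl)
    where
    z = B ^ (a ⊔ b)
    x+y≤2z : x + y ≤ 2 * z
    x+y≤2z = +-mono-≤ (bound (⊑-mono (m≤m⊔n a b) p))
               (subst (y ≤_) (sym (+-identityʳ z)) (bound (⊑-mono (m≤n⊔m a b) q)))

  Sized : ∀ α → ⟦ α ⟧ → ℕ → Set
  Sized nat       n       e = n ⊑ e
  Sized bool      _       e = ⊤
  Sized (list α)  xs      e = length xs ⊑ e × All (λ x → Sized α x e) xs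
  Sized (maybe α) x       e = MAll.All (λ x → Sized α x e) x
  Sized (α ⊗ β)   (x , y) e = Sized α x e × Sized β y e

  Sized-mono : ∀ α {v} → a ≤ b → Sized α v a → Sized α v b
  Sized-mono nat       a≤b p        = ⊑-mono a≤b p
  Sized-mono bool      a≤b p        = tt
  Sized-mono (list α)  a≤b (p , ps) = ⊑-mono a≤b p , All.map (Sized-mono α a≤b) ps
  Sized-mono (maybe α) a≤b p        = MAll.map (Sized-mono α a≤b) p
  Sized-mono (α ⊗ β)   a≤b (p , q)  = Sized-mono α a≤b p , Sized-mono β a≤b q

  Sized-[] : Sized (list α) [] 0
  Sized-[] = 0⊑0 , []

  Sized-∷ : ∀ {v vs} → Sized α v a → Sized (list α) vs b → Sized (list α) (v ∷ vs) (a ⊞ b)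
  Sized-∷ {α} {a} {b} p (q , qs) =
    ⊑-mono (s≤s (m≤n⊔m a b)) (1⊑0 ⊕ q) ,
    Sized-mono α (m≤n⇒m≤1+n (m≤m⊔n a b)) p ∷
    All.map (Sized-mono α (m≤n⇒m≤1+n (m≤n⊔m a b))) qs

  Sized-++ : ∀ {vs ws} → Sized (list α) vs a → Sized (list α) ws b → Sized (list α) (vs ++ ws) (a ⊞ b)
  Sized-++ {α} {a} {b} {vs} (p , ps) (q , qs) =
    subst (_⊑ _) (sym (length-++ vs)) (p ⊕ q) ,
    Allₚ.++⁺ (All.map (Sized-mono α (m≤n⇒m≤1+n (m≤m⊔n a b))) ps)
             (All.map (Sized-mono α (m≤n⇒m≤1+n (m≤n⊔m a b))) qs)

  Sized-tail : ∀ {v vs} → Sized (list α) (v ∷ vs) a → Sized (list α) vs a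
  Sized-tail (p , _ ∷ ps) = ⊑-≤ (n≤1+n _) p , ps

  Sized-map : ∀ {g : ⟦ α ⟧ → ⟦ β ⟧} {vs} → Sized (list α) vs a →
              (∀ {v} → Sized α v a → Sized β (g v) b) → Sized (list β) (map g vs) (a ⊔ b)
  Sized-map {β = β} {a} {b} {g} {vs} (p , ps) q =
    subst (_⊑ _) (sym (length-map g vs)) (⊑-mono (m≤m⊔n a b) p) ,
    Allₚ.map⁺ (All.map (λ s → Sized-mono β (m≤n⊔m a b) (q s)) ps)

  length-concatMap-≤ : ∀ {A C : Set} (g : A → List C) xs → All (λ x → length (g x) ≤ k) xs →
                       length (concatMap g xs) ≤ length xs * k
  length-concatMap-≤ g []       []       = z≤n
  length-concatMap-≤ g (x ∷ xs) (p ∷ ps) =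
    subst (_≤ _) (sym (length-++ (g x))) (+-mono-≤ p (length-concatMap-≤ g xs ps))

  -- The exponents add because the length is at most the number of pieces times the length of the
  -- longest piece.
  Sized-concatMap : ∀ {g : ⟦ α ⟧ → List ⟦ β ⟧} {vs} → Sized (list α) vs a →
                    (∀ {v} → Sized α v a → Sized (list β) (g v) b) →
                    Sized (list β) (concatMap g vs) (a + b)
  Sized-concatMap {β = β} {a} {b} {g} {vs} (p , ps) q =
    ⊑-≤ (length-concatMap-≤ g vs (All.map (λ s → bound (proj₁ (q s))) ps)) (p ⊛ bounded ≤-refl) ,
    Allₚ.concat⁺ (Allₚ.map⁺ (All.map (λ s → All.map (Sized-mono β (m≤n+m b a)) (proj₂ (q s))) ps))

  Sized-upTo : k ⊑ e → Sized (list nat) (upTo k) e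
  Sized-upTo {k} k⊑ = subst (_⊑ _) (sym (length-upTo k)) k⊑ ,
    Allₚ.applyUpTo⁺₁ (λ i → i) k (λ i<k → ⊑-≤ (<⇒≤ i<k) k⊑)

-- Codes of exponents. They are data rather than numbers so that the exponents
-- inferred for composite terms stay folded: unfolded, they grow exponentially
-- with the nesting depth. For the same reason a binder's cost is a function of
-- the exponent of the bound value.
data Cost : Set where
  level : ℕ → Cost
  unary-cost upTo-cost : Cost → Cost
  add-cost mul-cost sub-cost test-cost pair-cost cons-cost ++-cost : Cost → Cost → Cost
  ite-cost : Cost → Cost → Cost → Cost
  bind-cost any-cost map-cost filter-cost concatMap-cost least-cost : Cost → (ℕ → Cost) → Cost
  case-cost : Cost → Cost → (ℕ → Cost) → Cost
  rec-cost : Cost → Cost → ℕ → (ℕ → ℕ → Cost) → Cost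

private
  -- In these exponents the left operand of the outer `⊔` bounds the time and the right one the size
  -- of the value. The time is a sum in the order of evaluation; its initial `0` stands for the unit
  -- step, 1 = B⁰.
  unary : ℕ → ℕ
  unary a = (0 ⊞ a ⊞ 0) ⊔ a

  cons′ ++′ : ℕ → ℕ → ℕ
  cons′ a b = (0 ⊞ a ⊞ b ⊞ 0) ⊔ (a ⊞ b)

  ite′ : ℕ → ℕ → ℕ → ℕ
  ite′ a b c = (0 ⊞ a ⊞ (b ⊔ c)) ⊔ (b ⊔ c)

  case′ : ℕ → ℕ → (ℕ → ℕ) → ℕ
  case′ a b c = (0 ⊞ a ⊞ (b ⊔ c a)) ⊔ (b ⊔ c a)

  -- `a` is for the argument, `b` for the base case, `c` for all accumulators and `d` for the step.
  -- There are at most B^a iterations, hence `a` is added to the exponent of a single one.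
  rec : ℕ → ℕ → ℕ → (ℕ → ℕ → ℕ) → ℕ
  rec a b c d = (0 ⊞ a ⊞ (b ⊞ (a + (0 ⊞ d a c)))) ⊔ c

  ++′ a b = rec a b (a ⊞ b) cons′

expo : Cost → ℕ
expo (level e)            = e
expo (unary-cost a)       = unary (expo a)
expo (upTo-cost a)        = rec (expo a) 0 (expo a) λ e e′ → ++′ e′ (cons′ e 0)
expo (add-cost a b)       = (0 ⊞ expo a ⊞ expo b ⊞ (expo a ⊞ expo b) ⊞ (expo a ⊞ expo b)) ⊔ (expo a ⊞ expo b)
expo (mul-cost a b)       = (0 ⊞ expo a ⊞ expo b ⊞ (expo a ⊞ expo b) ⊞ (expo a + expo b)) ⊔ (expo a + expo b)
expo (sub-cost a b)       = (0 ⊞ expo a ⊞ expo b ⊞ (expo a ⊞ expo b) ⊞ expo a) ⊔ expo a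
expo (test-cost a b)      = (0 ⊞ expo a ⊞ expo b ⊞ expo a ⊞ expo b) ⊔ 0
expo (pair-cost a b)      = (0 ⊞ expo a ⊞ expo b ⊞ 0) ⊔ (expo a ⊔ expo b)
expo (cons-cost a b)      = cons′ (expo a) (expo b)
expo (++-cost a b)        = ++′ (expo a) (expo b)
expo (ite-cost a b c)     = ite′ (expo a) (expo b) (expo c)
expo (bind-cost a b)      = (0 ⊞ expo a ⊞ expo (b (expo a))) ⊔ expo (b (expo a))
expo (any-cost a b)       = rec (expo a) 0 0 λ e e′ → ite′ (expo (b e)) 0 e′
expo (map-cost a b)       = rec (expo a) 0 (expo a ⊔ expo (b (expo a))) λ e e′ → cons′ (expo (b e)) e′
expo (filter-cost a b)    = rec (expo a) 0 (expo a) λ e e′ → ite′ (expo (b e)) (cons′ e e′) e′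
expo (concatMap-cost a b) = rec (expo a) 0 (expo a + expo (b (expo a))) λ e e′ → ++′ (expo (b e)) e′
expo (least-cost a b)     = rec (expo a) 0 (expo a) λ e e′ → case′ e′ (ite′ (expo (b e)) (unary e) 0) unary
expo (case-cost a b c)    = case′ (expo a) (expo b) λ e → expo (c e)
expo (rec-cost a b c d)   = rec (expo a) (expo b) c λ e e′ → expo (d e e′)

-- Rules for evaluating terms

module Calculus (B : ℕ) (2≤B : 2 ≤ B) where

  open Bounds B 2≤B

  infix 4 _⇓_∥_

  private variable
    α β : Ty
    a b c d e : Cost
    x y k i j : ℕ

  -- t evaluates to v, and both the time taken and the numbers and lengths in v
  -- are at most B ^ expo e.
  record _⇓_∥_ (t : Tm ⟦_⟧ α) (v : ⟦ α ⟧) (e : Cost) : Set where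
    constructor mk
    field
      value≡ : value (eval t) ≡ v
      time⊑  : time (eval t) ⊑ expo e
      sized  : Sized α v (expo e)
  open _⇓_∥_ public

  -- `i` and `j` are read off the bounds supplied. The equation for `e` is the only place where a
  -- code is compared with its exponent.
  run⇓ : {t : Tm ⟦_⟧ α} {v : ⟦ α ⟧} → value (eval t) ≡ v → time (eval t) ⊑ i → Sized α v j →
         expo e ≡ i ⊔ j → t ⇓ v ∥ e
  run⇓ {α} {i} {j} {e} p q r e≡ =
    mk p (⊑-mono (≤-trans (m≤m⊔n i j) (≤-reflexive (sym e≡))) q)
         (Sized-mono α (≤-trans (m≤n⊔m i j) (≤-reflexive (sym e≡))) r)

  evaluates : {t : Tm ⟦_⟧ α} → time (eval t) ⊑ i → Sized α (value (eval t)) j →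
              expo e ≡ i ⊔ j → t ⇓ value (eval t) ∥ e
  evaluates = run⇓ refl

  ⇓-≡ : {t : Tm ⟦_⟧ α} {v w : ⟦ α ⟧} → v ≡ w → t ⇓ v ∥ e → t ⇓ w ∥ e
  ⇓-≡ refl p = p

  -- Exchanges the `rec-cost` of an expanded recursion for a short code such as `any-cost`, whose
  -- exponent is the same by definition.
  recost : {t : Tm ⟦_⟧ α} {v : ⟦ α ⟧} → expo a ≡ expo b → t ⇓ v ∥ a → t ⇓ v ∥ b
  recost {α = α} a≡b (mk p q r) = mk p (subst (_ ⊑_) a≡b q) (subst (Sized α _) a≡b r)

  var⇓ : {v : ⟦ α ⟧} → Sized α v i → var v ⇓ v ∥ level i
  var⇓ p = mk refl (⊑-mono z≤n 1⊑0) p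

  open Code

  -- The body is analysed for a variable of unknown exponent and then instantiated at that of `t`.
  -- Reading the variable again is a single step, however long `t` took.
  bind⇓ : {t : Tm ⟦_⟧ α} {u : ⟦ α ⟧ → Tm ⟦_⟧ β} {v : ⟦ α ⟧} {w : ⟦ β ⟧} →
          {b : ℕ → Cost} → t ⇓ v ∥ a →
          (∀ {e} → var v ⇓ v ∥ level e → u v ⇓ w ∥ b e) →
          bind t u ⇓ w ∥ bind-cost a b
  bind⇓ (mk refl p q) f with f (var⇓ q)
  ... | mk refl r s = evaluates (1⊑0 ⊕ p ⊕ r) s refl

  lit⇓ : k ⊑ i → lit k ⇓ k ∥ level i
  lit⇓ p = mk refl (⊑-mono z≤n 1⊑0) p

  lit0⇓ : lit 0 ⇓ 0 ∥ level 0
  lit0⇓ = lit⇓ 0⊑0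

  lit1⇓ : lit 1 ⇓ 1 ∥ level 0
  lit1⇓ = lit⇓ 1⊑0

  lit2⇓ : lit 2 ⇓ 2 ∥ level 1
  lit2⇓ = lit⇓ 2⊑1

  add⇓ : {t u : Tm ⟦_⟧ nat} → t ⇓ x ∥ a → u ⇓ y ∥ b → add t u ⇓ x + y ∥ add-cost a b
  add⇓ (mk refl p q) (mk refl r s) = evaluates (1⊑0 ⊕ p ⊕ r ⊕ (q ⊕ s) ⊕ (q ⊕ s)) (q ⊕ s) refl

  mul⇓ : {t u : Tm ⟦_⟧ nat} → t ⇓ x ∥ a → u ⇓ y ∥ b → mul t u ⇓ x * y ∥ mul-cost a b
  mul⇓ (mk refl p q) (mk refl r s) = evaluates (1⊑0 ⊕ p ⊕ r ⊕ (q ⊕ s) ⊕ (q ⊛ s)) (q ⊛ s) refl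

  sub⇓ : {t u : Tm ⟦_⟧ nat} → t ⇓ x ∥ a → u ⇓ y ∥ b → sub t u ⇓ x ∸ y ∥ sub-cost a b
  sub⇓ {x} {y = y} (mk refl p q) (mk refl r s) = evaluates (1⊑0 ⊕ p ⊕ r ⊕ (q ⊕ s) ⊕ diff⊑) diff⊑ refl
    where diff⊑ = ⊑-≤ (m∸n≤m x y) q

  eq⇓ : {t u : Tm ⟦_⟧ nat} → t ⇓ x ∥ a → u ⇓ y ∥ b → eq t u ⇓ does (x ≟ y) ∥ test-cost a b
  eq⇓ (mk refl p q) (mk refl r s) = evaluates {j = 0} (1⊑0 ⊕ p ⊕ r ⊕ q ⊕ s) tt refl

  lt⇓ : {t u : Tm ⟦_⟧ nat} → t ⇓ x ∥ a → u ⇓ y ∥ b → lt t u ⇓ does (x <? y) ∥ test-cost a b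
  lt⇓ (mk refl p q) (mk refl r s) = evaluates {j = 0} (1⊑0 ⊕ p ⊕ r ⊕ q ⊕ s) tt refl

  yes⇓ : yes ⇓ true ∥ level 0
  yes⇓ = mk refl 1⊑0 tt

  no⇓ : no ⇓ false ∥ level 0
  no⇓ = mk refl 1⊑0 tt

  ite⇓ : ∀ {s b} {t u : Tm ⟦_⟧ α} {v w} → s ⇓ b ∥ a → t ⇓ v ∥ c → u ⇓ w ∥ d →
         ite s t u ⇓ (if b then v else w) ∥ ite-cost a c d
  ite⇓ {α} {c = c} {d} {s = s} {t = t} {u} {v} {w} (mk refl p _) (mk q r x) (mk q′ r′ x′) =
    run⇓ (same (value (eval s))) (1⊑0 ⊕ p ⊕ fast (value (eval s))) (small (value (eval s))) refl
    where
    same : ∀ b → value (if b then eval t else eval u) ≡ (if b then v else w)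
    same true  = q
    same false = q′
    fast : ∀ b → time (if b then eval t else eval u) ⊑ expo c ⊔ expo d
    fast true  = ⊑-mono (m≤m⊔n (expo c) (expo d)) r
    fast false = ⊑-mono (m≤n⊔m (expo c) (expo d)) r′
    small : ∀ b → Sized α (if b then v else w) (expo c ⊔ expo d)
    small true  = Sized-mono α (m≤m⊔n (expo c) (expo d)) x
    small false = Sized-mono α (m≤n⊔m (expo c) (expo d)) x′

  pair⇓ : {t : Tm ⟦_⟧ α} {u : Tm ⟦_⟧ β} {v : ⟦ α ⟧} {w : ⟦ β ⟧} →
          t ⇓ v ∥ a → u ⇓ w ∥ b → pair t u ⇓ (v , w) ∥ pair-cost a b
  pair⇓ {α} {β} {a} {b} (mk refl p q) (mk refl r s) = evaluates (1⊑0 ⊕ p ⊕ r ⊕ 0⊑0)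
    (Sized-mono α (m≤m⊔n (expo a) (expo b)) q , Sized-mono β (m≤n⊔m (expo a) (expo b)) s) refl

  fst⇓ : {t : Tm ⟦_⟧ (α ⊗ β)} {v : ⟦ α ⊗ β ⟧} → t ⇓ v ∥ a → fst t ⇓ proj₁ v ∥ unary-cost a
  fst⇓ (mk refl p (q , _)) = evaluates (1⊑0 ⊕ p ⊕ 0⊑0) q refl

  snd⇓ : {t : Tm ⟦_⟧ (α ⊗ β)} {v : ⟦ α ⊗ β ⟧} → t ⇓ v ∥ a → snd t ⇓ proj₂ v ∥ unary-cost a
  snd⇓ (mk refl p (_ , q)) = evaluates (1⊑0 ⊕ p ⊕ 0⊑0) q refl

  none⇓ : none {α = α} ⇓ nothing ∥ level 0
  none⇓ = mk refl 1⊑0 nothing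

  some⇓ : {t : Tm ⟦_⟧ α} {v : ⟦ α ⟧} → t ⇓ v ∥ a → some t ⇓ just v ∥ unary-cost a
  some⇓ (mk refl p q) = evaluates (1⊑0 ⊕ p ⊕ 0⊑0) (just q) refl

  -- The `just` branch learns where its value came from. This is how the equation defining k becomes
  -- available when the permutations of b k points are bounded.
  caseMaybe⇓ : {t : Tm ⟦_⟧ (maybe α)} {n : Tm ⟦_⟧ β} {j : ⟦ α ⟧ → Tm ⟦_⟧ β}
               {mv : Maybe ⟦ α ⟧} {f : ⟦ α ⟧ → ⟦ β ⟧} {w : ⟦ β ⟧} {c′ : ℕ → Cost} →
               t ⇓ mv ∥ a → n ⇓ w ∥ b →
               (∀ {x e} → mv ≡ just x → var x ⇓ x ∥ level e → j x ⇓ f x ∥ c′ e) →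
               caseMaybe t n j ⇓ maybe′ f w mv ∥ case-cost a b c′
  caseMaybe⇓ {α} {β} {a} {b} {t} {n} {j} {f = f} {w} {c′} (mk refl p q) (mk q′ r′ x′) some-case =
    run⇓ (same q some-case) (⊑-≤ (fast q some-case) (1⊑0 ⊕ power⊑ A ⊕ power⊑ E)) (small q some-case) refl
    where
    A = expo a
    E = expo b ⊔ expo (c′ A)
    b≤E = m≤m⊔n (expo b) (expo (c′ A))
    c≤E = m≤n⊔m (expo b) (expo (c′ A))
    -- The hypotheses are restated for an arbitrary value so that `with` can split on the value of
    -- `t` in all of them at once.
    S : Maybe ⟦ α ⟧ → Set
    S mv = Sized (maybe α) mv A
    H : Maybe ⟦ α ⟧ → Set
    H mv = ∀ {x e} → mv ≡ just x → var x ⇓ x ∥ level e → j x ⇓ f x ∥ c′ e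
    same : S (value (eval t)) → H (value (eval t)) →
           value (eval (caseMaybe t n j)) ≡ maybe′ f w (value (eval t))
    same σ h with value (eval t) | σ
    ... | nothing | _      = q′
    ... | just x  | just σ = value≡ (h {e = A} refl (var⇓ σ))
    fast : S (value (eval t)) → H (value (eval t)) →
           time (eval (caseMaybe t n j)) ≤ 1 + (B ^ A + B ^ E)
    fast σ h with value (eval t) | σ
    ... | nothing | _      = s≤s (+-mono-≤ (bound p) (bound (⊑-mono b≤E r′)))
    ... | just x  | just σ = s≤s (+-mono-≤ (bound p) (bound (⊑-mono c≤E (time⊑ (h refl (var⇓ σ))))))
    small : S (value (eval t)) → H (value (eval t)) → Sized β (maybe′ f w (value (eval t))) E
    small σ h with value (eval t) | σ
    ... | nothing | _      = Sized-mono β b≤E x′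
    ... | just x  | just σ = Sized-mono β c≤E (sized (h refl (var⇓ σ)))

  nil⇓ : nil {α = α} ⇓ [] ∥ level 0
  nil⇓ = mk refl 1⊑0 Sized-[]

  cons⇓ : {t : Tm ⟦_⟧ α} {u : Tm ⟦_⟧ (list α)} {v : ⟦ α ⟧} {vs : List ⟦ α ⟧} →
          t ⇓ v ∥ a → u ⇓ vs ∥ b → cons t u ⇓ v ∷ vs ∥ cons-cost a b
  cons⇓ (mk refl p q) (mk refl r s) = evaluates (1⊑0 ⊕ p ⊕ r ⊕ 0⊑0) (Sized-∷ q s) refl

  -- `g i` is the accumulator after i iterations. Its size is a premise of its own, with one
  -- exponent `c` for all i up to k, and is not derived from the steps.
  recNat⇓ : {n : Tm ⟦_⟧ nat} {z : Tm ⟦_⟧ α} {s : ℕ → ⟦ α ⟧ → Tm ⟦_⟧ α}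
            {c : ℕ} {d : ℕ → ℕ → Cost} (g : ℕ → ⟦ α ⟧) →
            n ⇓ k ∥ a → z ⇓ g 0 ∥ b → (∀ {i} → i ≤ k → Sized α (g i) c) →
            (∀ {i e e′} → i < k → var i ⇓ i ∥ level e → var (g i) ⇓ g i ∥ level e′ →
              s i (g i) ⇓ g (suc i) ∥ d e e′) →
            recNat n z s ⇓ g k ∥ rec-cost a b c d
  recNat⇓ {α} {k} {a} {b} {n} {z} {s} {c} {d} g (mk refl p q) (mk z≡ r _) size step =
    run⇓ (proj₁ (iter k ≤-refl)) (1⊑0 ⊕ p ⊕ ⊑-≤ (proj₂ (iter k ≤-refl)) (r ⊕ q ⊛ (1⊑0 ⊕ power⊑ D)))
         (size ≤-refl) refl
    where
    D = expo (d (expo a) c)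
    loop : ℕ → Timed ⟦ α ⟧
    loop = iterNat (eval z) (λ n r → eval (s n r))
    iter : ∀ i → i ≤ k → value (loop i) ≡ g i × time (loop i) ≤ time (eval z) + i * (1 + B ^ D)
    iter zero    _   = z≡ , m≤m+n _ 0
    iter (suc i) i<k with value (loop i) | iter i (<⇒≤ i<k)
    ... | _ | refl , t≤ with step i<k (var⇓ (⊑-≤ (<⇒≤ i<k) q)) (var⇓ (size (<⇒≤ i<k)))
    ... | mk v≡ (bounded t′≤) _ = v≡ ,
      ≤-trans (+-mono-≤ t≤ (s≤s t′≤))
        (≤-reflexive (trans (+-assoc (time (eval z)) _ _)
                            (cong (time (eval z) +_) (+-comm (i * (1 + B ^ D)) _))))

  -- The size premise covers all lists bounded like the argument; the suffixes met by the recursion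
  -- are among them.
  recList⇓ : {n : Tm ⟦_⟧ (list α)} {z : Tm ⟦_⟧ β} {s : ⟦ α ⟧ → List ⟦ α ⟧ → ⟦ β ⟧ → Tm ⟦_⟧ β}
             {vs : List ⟦ α ⟧} {c : ℕ} {d : ℕ → ℕ → Cost} (g : List ⟦ α ⟧ → ⟦ β ⟧) →
             n ⇓ vs ∥ a → z ⇓ g [] ∥ b → (∀ {ws} → Sized (list α) ws (expo a) → Sized β (g ws) c) →
             (∀ {w ws e e′} → var w ⇓ w ∥ level e → var ws ⇓ ws ∥ level e → var (g ws) ⇓ g ws ∥ level e′ →
               s w ws (g ws) ⇓ g (w ∷ ws) ∥ d e e′) →
             recList n z s ⇓ g vs ∥ rec-cost a b c d
  recList⇓ {α} {β} {a} {b} {n} {z} {s} {vs} {c} {d} g (mk refl p q) (mk z≡ r _) size step =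
    run⇓ (proj₁ (iter vs q)) (1⊑0 ⊕ p ⊕ ⊑-≤ (proj₂ (iter vs q)) (r ⊕ proj₁ q ⊛ (1⊑0 ⊕ power⊑ D))) (size q) refl
    where
    D = expo (d (expo a) c)
    loop : List ⟦ α ⟧ → Timed ⟦ β ⟧
    loop = iterList (eval z) (λ x xs r → eval (s x xs r))
    iter : ∀ ws → Sized (list α) ws (expo a) →
           value (loop ws) ≡ g ws × time (loop ws) ≤ time (eval z) + length ws * (1 + B ^ D)
    iter []       _ = z≡ , m≤m+n _ 0
    iter (w ∷ ws) σ with value (loop ws) | iter ws (Sized-tail σ)
    ... | _ | refl , t≤ with step (var⇓ (All.head (proj₂ σ))) (var⇓ (Sized-tail σ)) (var⇓ (size (Sized-tail σ)))
    ... | mk v≡ (bounded t′≤) _ = v≡ ,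
      ≤-trans (+-mono-≤ t≤ (s≤s t′≤))
        (≤-reflexive (trans (+-assoc (time (eval z)) _ _)
                            (cong (time (eval z) +_) (+-comm (length ws * (1 + B ^ D)) _))))

  notᵗ⇓ : ∀ {s b} → s ⇓ b ∥ a → notᵗ s ⇓ not b ∥ ite-cost a (level 0) (level 0)
  notᵗ⇓ {b = true}  p = ite⇓ p no⇓ yes⇓
  notᵗ⇓ {b = false} p = ite⇓ p no⇓ yes⇓

  ∧ᵗ⇓ : ∀ {s t b c} → s ⇓ b ∥ d → t ⇓ c ∥ e → (s ∧ᵗ t) ⇓ b ∧ c ∥ ite-cost d e (level 0)
  ∧ᵗ⇓ {b = true}  p q = ite⇓ p q no⇓
  ∧ᵗ⇓ {b = false} p q = ite⇓ p q no⇓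

  ∨ᵗ⇓ : ∀ {s t b c} → s ⇓ b ∥ d → t ⇓ c ∥ e → (s ∨ᵗ t) ⇓ b ∨ c ∥ ite-cost d (level 0) e
  ∨ᵗ⇓ {b = true}  p q = ite⇓ p yes⇓ q
  ∨ᵗ⇓ {b = false} p q = ite⇓ p yes⇓ q

  -- Stated for the expansion of `anyᵗ`, where `f` is applied to a bound value and can be found by
  -- unification. `does (any? P? vs)` unfolds to the same chain of disjunctions.
  anyᵗ⇓ : {b : ℕ → Cost} {f : ⟦ α ⟧ → Tm ⟦_⟧ bool} {P : Pred ⟦ α ⟧ 0ℓ} {P? : Decidable P}
          {t : Tm ⟦_⟧ (list α)} {vs : List ⟦ α ⟧} →
          (∀ {v e} → var v ⇓ v ∥ level e → f v ⇓ does (P? v) ∥ b e) → t ⇓ vs ∥ a →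
          recList t no (λ x _ r → f x ∨ᵗ var r) ⇓ does (any? P? vs) ∥ any-cost a b
  anyᵗ⇓ {P? = P?} f⇓ t⇓ =
    recost refl (recList⇓ {c = 0} (λ ws → does (any? P? ws)) t⇓ no⇓ (λ _ → tt) λ w⇓ _ r⇓ → ∨ᵗ⇓ (f⇓ w⇓) r⇓)

  mapᵗ⇓ : {b : ℕ → Cost} {f : ⟦ α ⟧ → Tm ⟦_⟧ β} {g : ⟦ α ⟧ → ⟦ β ⟧} {t : Tm ⟦_⟧ (list α)} {vs : List ⟦ α ⟧} →
          (∀ {v e} → var v ⇓ v ∥ level e → f v ⇓ g v ∥ b e) → t ⇓ vs ∥ a →
          recList t nil (λ x _ r → cons (f x) (var r)) ⇓ map g vs ∥ map-cost a b
  mapᵗ⇓ {g = g} f⇓ t⇓ =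
    recost refl (recList⇓ (map g) t⇓ nil⇓ (λ σ → Sized-map σ (λ τ → sized (f⇓ (var⇓ τ))))
      λ w⇓ _ r⇓ → cons⇓ (f⇓ w⇓) r⇓)

  Sized-filter : ∀ {P : Pred ⟦ α ⟧ 0ℓ} (P? : Decidable P) {vs} →
                 Sized (list α) vs i → Sized (list α) (filter P? vs) i
  Sized-filter P? {vs} (p , ps) = ⊑-≤ (length-filter P? vs) p , Allₚ.filter⁺ P? ps

  filterᵗ⇓ : {b : ℕ → Cost} {f : ⟦ α ⟧ → Tm ⟦_⟧ bool} {P : Pred ⟦ α ⟧ 0ℓ} {P? : Decidable P}
             {t : Tm ⟦_⟧ (list α)} {vs : List ⟦ α ⟧} →
             (∀ {v e} → var v ⇓ v ∥ level e → f v ⇓ does (P? v) ∥ b e) → t ⇓ vs ∥ a →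
             recList t nil (λ x _ r → ite (f x) (cons (var x) (var r)) (var r)) ⇓ filter P? vs ∥ filter-cost a b
  filterᵗ⇓ {P? = P?} f⇓ t⇓ =
    recost refl (recList⇓ (filter P?) t⇓ nil⇓ (Sized-filter P?)
      λ {w} {ws} w⇓ _ r⇓ → ⇓-≡ (sym (filter-∷ w ws)) (ite⇓ (f⇓ w⇓) (cons⇓ w⇓ r⇓) r⇓))
    where
    filter-∷ : ∀ w ws → filter P? (w ∷ ws) ≡ (if does (P? w) then w ∷ filter P? ws else filter P? ws)
    filter-∷ w ws with does (P? w)
    ... | true  = refl
    ... | false = refl

  ++ᵗ⇓ : {t u : Tm ⟦_⟧ (list α)} {vs ws : List ⟦ α ⟧} → t ⇓ vs ∥ a → u ⇓ ws ∥ b →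
         (t ++ᵗ u) ⇓ vs ++ ws ∥ ++-cost a b
  ++ᵗ⇓ {α = α} {ws = ws} t⇓ u⇓ =
    recost refl (recList⇓ (_++ ws) t⇓ u⇓ (λ σ → Sized-++ {α} σ (sized u⇓)) λ w⇓ _ r⇓ → cons⇓ w⇓ r⇓)

  concatMapᵗ⇓ : {b : ℕ → Cost} {f : ⟦ α ⟧ → Tm ⟦_⟧ (list β)} {g : ⟦ α ⟧ → List ⟦ β ⟧}
                {t : Tm ⟦_⟧ (list α)} {vs : List ⟦ α ⟧} →
                (∀ {v e} → var v ⇓ v ∥ level e → f v ⇓ g v ∥ b e) → t ⇓ vs ∥ a →
                recList t nil (λ x _ r → f x ++ᵗ var r) ⇓ concatMap g vs ∥ concatMap-cost a b
  concatMapᵗ⇓ {α} {β} {g = g} f⇓ t⇓ =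
    recost refl (recList⇓ (concatMap g) t⇓ nil⇓ (λ σ → Sized-concatMap {α} {β} σ (λ τ → sized (f⇓ (var⇓ τ))))
      λ w⇓ _ r⇓ → ++ᵗ⇓ (f⇓ w⇓) r⇓)

  upToᵗ⇓ : {t : Tm ⟦_⟧ nat} → t ⇓ k ∥ a → upToᵗ t ⇓ upTo k ∥ upTo-cost a
  upToᵗ⇓ t⇓ = recost refl (recNat⇓ upTo t⇓ nil⇓ (λ i≤k → Sized-upTo (⊑-≤ i≤k (sized t⇓)))
    λ {i} _ i⇓ r⇓ → ⇓-≡ (upTo-∷ʳ i) (++ᵗ⇓ r⇓ (cons⇓ i⇓ nil⇓)))

  -- A witness found is below k, so the exponent of k serves for all accumulators. The test is given
  -- `i < k`, which in the girth computation limits the length of the paths.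
  leastᵗ⇓ : {f : ℕ → Tm ⟦_⟧ bool} {P : Pred ℕ 0ℓ} {P? : Decidable P}
            {t : Tm ⟦_⟧ nat} {b : ℕ → Cost} → t ⇓ k ∥ a →
            (∀ {i e} → i < k → var i ⇓ i ∥ level e → f i ⇓ does (P? i) ∥ b e) →
            recNat t none (λ i r → caseMaybe (var r) (ite (f i) (some (var i)) none) (λ j → some (var j)))
              ⇓ least P? k ∥ least-cost a b
  leastᵗ⇓ {k} {a} {P? = P?} t⇓ f⇓ =
    recost refl (recNat⇓ (least P?) t⇓ none⇓ size
      λ i<k i⇓ r⇓ → caseMaybe⇓ r⇓ (ite⇓ (f⇓ i<k i⇓) (some⇓ i⇓) none⇓) λ _ j⇓ → some⇓ j⇓)
    where
    size : ∀ {i} → i ≤ k → Sized (maybe nat) (least P? i) (expo a)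
    size {i} i≤k with least P? i in e
    ... | nothing = nothing
    ... | just j  = just (⊑-≤ (<⇒≤ (<-≤-trans (proj₁ (least-just P? i e)) i≤k)) (sized t⇓))

  dividesᵗ⇓ : {t u : Tm ⟦_⟧ nat} → t ⇓ x ∥ a → u ⇓ y ∥ b → dividesᵗ t u ⇓ does (x ∣? y) ∥ _
  dividesᵗ⇓ {x} {y = y} t⇓ u⇓ =
    ⇓-≡ (does-⇔ (mk⇔ to from) (any? (λ q → q * x ≟ y) (upTo (y + 1))) (x ∣? y))
      (anyᵗ⇓ (λ q⇓ → eq⇓ (mul⇓ q⇓ t⇓) u⇓) (upToᵗ⇓ (add⇓ u⇓ lit1⇓)))
    where
    to : Any (λ q → q * x ≡ y) (upTo (y + 1)) → x ∣ y
    to h = let q , q*x≡y = Any.satisfied h in divides q (sym q*x≡y)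
    from : x ∣ y → Any (λ q → q * x ≡ y) (upTo (y + 1))
    from x∣y = let q , q<y+1 , q*x≡y = bounded-quotient x∣y in lose (∈-upTo⁺ q<y+1) q*x≡y

  coprimeᵗ⇓ : {t u : Tm ⟦_⟧ nat} → t ⇓ x ∥ a → u ⇓ y ∥ b → coprimeᵗ t u ⇓ does (coprime′? x y) ∥ _
  coprimeᵗ⇓ t⇓ u⇓ =
    notᵗ⇓ (anyᵗ⇓ (λ d⇓ → ∧ᵗ⇓ (lt⇓ lit1⇓ d⇓) (∧ᵗ⇓ (dividesᵗ⇓ d⇓ t⇓) (dividesᵗ⇓ d⇓ u⇓)))
                 (upToᵗ⇓ (add⇓ u⇓ lit1⇓)))

  Line⊑ : ℕ → ℕ → List ℕ → Set
  Line⊑ e n ys = length ys ≡ n × All (_⊑ e) ys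

  insertions⊑ : ∀ {n ys} → x ⊑ i → Line⊑ i n ys → All (Line⊑ i (suc n)) (insertions x ys)
  insertions⊑ {ys = []}     p (refl , qs)     = (refl , p ∷ qs) ∷ []
  insertions⊑ {ys = y ∷ ys} p (refl , q ∷ qs) =
    (refl , p ∷ q ∷ qs) ∷
    Allₚ.map⁺ (All.map (λ (l , rs) → cong suc l , q ∷ rs) (insertions⊑ p (refl , qs)))

  Sized-insertions : ∀ {ys} → x ⊑ i → Sized (list nat) ys j →
                     Sized (list (list nat)) (insertions x ys) (i ⊞ j)
  Sized-insertions {x} {i} {j} {ys} p (q , qs) =
    subst (_⊑ _) (sym (length-insertions x ys)) l⊑ ,
    All.map (λ (l , rs) → subst (_⊑ _) (sym l) l⊑ , rs)
      (insertions⊑ (⊑-mono (m≤n⇒m≤1+n (m≤m⊔n i j)) p)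
                   (refl , All.map (⊑-mono (m≤n⇒m≤1+n (m≤n⊔m i j))) qs))
    where
    l⊑ : suc (length ys) ⊑ i ⊞ j
    l⊑ = ⊑-mono (s≤s (m≤n⊔m i j)) (1⊑0 ⊕ q)

  insertionsᵗ⇓ : {t : Tm ⟦_⟧ nat} {u : Tm ⟦_⟧ (list nat)} {ys : List ℕ} →
                 t ⇓ x ∥ a → u ⇓ ys ∥ b → insertionsᵗ t u ⇓ insertions x ys ∥ _
  insertionsᵗ⇓ {x} t⇓ u⇓ =
    recList⇓ (insertions x) u⇓ (cons⇓ (cons⇓ t⇓ nil⇓) nil⇓) (Sized-insertions (sized t⇓))
      λ z⇓ zs⇓ r⇓ → cons⇓ (cons⇓ t⇓ (cons⇓ z⇓ zs⇓)) (mapᵗ⇓ (cons⇓ z⇓) r⇓)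

  blocksᵗ⇓ : ∀ {t u w c n q} → t ⇓ c ∥ a → u ⇓ n ∥ b → w ⇓ q ∥ d → blocksᵗ t u w ⇓ blocks c n q ∥ _
  blocksᵗ⇓ t⇓ u⇓ w⇓ = concatMapᵗ⇓ (λ i⇓ → mapᵗ⇓ (add⇓ (mul⇓ i⇓ u⇓)) w⇓) (upToᵗ⇓ t⇓)

  shiftᵗ⇓ : ∀ {t u m j} → t ⇓ m ∥ a → u ⇓ j ∥ b → shiftᵗ t u ⇓ cyclicShift m j ∥ _
  shiftᵗ⇓ t⇓ u⇓ = ++ᵗ⇓ (mapᵗ⇓ (add⇓ (sub⇓ t⇓ u⇓)) (upToᵗ⇓ u⇓)) (upToᵗ⇓ (sub⇓ t⇓ u⇓))

  Sized-ones : ∀ {p} → Sized (list nat) p i → Sized (list (nat ⊗ nat)) (ones p) i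
  Sized-ones {i} {p} (l , ps) = subst (_⊑ _) (sym (length-ones p)) l ,
    zipped (proj₂ (Sized-upTo l)) ps
    where
    zipped : ∀ {xs ys} → All (_⊑ i) xs → All (_⊑ i) ys → All (λ e → proj₁ e ⊑ i × proj₂ e ⊑ i) (zip xs ys)
    zipped []       _        = []
    zipped (_ ∷ _)  []       = []
    zipped (q ∷ qs) (r ∷ rs) = (q , r) ∷ zipped qs rs

  onesᵗ⇓ : ∀ {t p} → t ⇓ p ∥ a → onesᵗ t ⇓ ones p ∥ _
  onesᵗ⇓ t⇓ = recList⇓ ones t⇓ nil⇓ Sized-ones
    λ {w} {ws} w⇓ _ r⇓ → ⇓-≡ (sym (ones-∷ w ws))
      (cons⇓ (pair⇓ lit0⇓ w⇓) (mapᵗ⇓ (λ e⇓ → pair⇓ (add⇓ lit1⇓ (fst⇓ e⇓)) (snd⇓ e⇓)) r⇓))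

  sameEdgeᵗ⇓ : {t u : Tm ⟦_⟧ (nat ⊗ nat)} {v w : ℕ × ℕ} → t ⇓ v ∥ a → u ⇓ w ∥ b →
               sameEdgeᵗ t u ⇓ does (v ≟ᵉ w) ∥ _
  sameEdgeᵗ⇓ t⇓ u⇓ = ∧ᵗ⇓ (eq⇓ (fst⇓ t⇓) (fst⇓ u⇓)) (eq⇓ (snd⇓ t⇓) (snd⇓ u⇓))

  compatibleᵗ⇓ : ∀ {t u p q} → t ⇓ p ∥ a → u ⇓ q ∥ b → compatibleᵗ t u ⇓ does (noCommonEdge? p q) ∥ _
  compatibleᵗ⇓ t⇓ u⇓ = bind⇓ (onesᵗ⇓ u⇓) λ es⇓ →
    notᵗ⇓ (anyᵗ⇓ (λ e⇓ → anyᵗ⇓ (sameEdgeᵗ⇓ e⇓) es⇓) (onesᵗ⇓ t⇓))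

  verticesᵗ⇓ : {t : Tm ⟦_⟧ nat} → t ⇓ k ∥ a → verticesᵗ t ⇓ vertices k ∥ _
  verticesᵗ⇓ t⇓ = ++ᵗ⇓ (mapᵗ⇓ (pair⇓ yes⇓) (upToᵗ⇓ t⇓)) (mapᵗ⇓ (pair⇓ no⇓) (upToᵗ⇓ t⇓))

  sameVertexᵗ⇓ : {t u : Tm ⟦_⟧ (bool ⊗ nat)} {v w : Vertex} → t ⇓ v ∥ a → u ⇓ w ∥ b →
                 sameVertexᵗ t u ⇓ does (v ≟ᵛ w) ∥ _
  sameVertexᵗ⇓ {v = v} {w} t⇓ u⇓ =
    ∧ᵗ⇓ (⇓-≡ (same (proj₁ v) (proj₁ w)) (ite⇓ (fst⇓ t⇓) (fst⇓ u⇓) (notᵗ⇓ (fst⇓ u⇓))))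
        (eq⇓ (snd⇓ t⇓) (snd⇓ u⇓))
    where
    same : ∀ b c → (if b then c else not c) ≡ does (b Bool.≟ c)
    same true  true  = refl
    same true  false = refl
    same false true  = refl
    same false false = refl

  adjacentᵗ⇓ : {t : Tm ⟦_⟧ (list (nat ⊗ nat))} {u w : Tm ⟦_⟧ (bool ⊗ nat)} {es : EdgeList} {v v′ : Vertex} →
               t ⇓ es ∥ a → u ⇓ v ∥ b → w ⇓ v′ ∥ c → adjacentᵗ t u w ⇓ does (joined? es v v′) ∥ _
  adjacentᵗ⇓ t⇓ u⇓ w⇓ = anyᵗ⇓ (λ e⇓ →
    ∨ᵗ⇓ (∧ᵗ⇓ (sameVertexᵗ⇓ u⇓ (pair⇓ yes⇓ (fst⇓ e⇓))) (sameVertexᵗ⇓ w⇓ (pair⇓ no⇓ (snd⇓ e⇓))))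
        (∧ᵗ⇓ (sameVertexᵗ⇓ w⇓ (pair⇓ yes⇓ (fst⇓ e⇓))) (sameVertexᵗ⇓ u⇓ (pair⇓ no⇓ (snd⇓ e⇓))))) t⇓

  headAdjacentᵗ⇓ : {t : Tm ⟦_⟧ (list (nat ⊗ nat))} {u : Tm ⟦_⟧ (bool ⊗ nat)} {w : Tm ⟦_⟧ (list (bool ⊗ nat))}
                   {es : EdgeList} {v : Vertex} {p : List Vertex} →
                   t ⇓ es ∥ a → u ⇓ v ∥ b → w ⇓ p ∥ c → headAdjacentᵗ t u w ⇓ does (headJoined? es v p) ∥ _
  headAdjacentᵗ⇓ {es = es} {v} t⇓ u⇓ w⇓ =
    recList⇓ {c = 0} (λ p → does (headJoined? es v p)) w⇓ no⇓ (λ _ → tt) λ v⇓ _ _ → adjacentᵗ⇓ t⇓ u⇓ v⇓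

  -- The exponentially long lists

  module Exponential (m M : ℕ) (2+m≤M : 2 + m ≤ M) (M^M⊑1 : M ^ M ⊑ 1) where

    private
      2≤M : 2 ≤ M
      2≤M = ≤-trans (m≤m+n 2 m) 2+m≤M

      m<M : m < M
      m<M = ≤-trans (n≤1+n (suc m)) 2+m≤M

      instance
        M≢0 : NonZero M
        M≢0 = >-nonZero (<-trans (s≤s z≤n) 2≤M)

    M⊑1 : M ⊑ 1
    M⊑1 = ⊑-≤ (≤-trans (≤-reflexive (sym (^-identityʳ M))) (^-monoʳ-≤ M (<⇒≤ 2≤M))) M^M⊑1

    permutations-lines : ∀ {n} → n ≤ m → All (Line⊑ 1 n) (permutations n)
    permutations-lines {zero}  _   = (refl , []) ∷ []
    permutations-lines {suc n} n<m =
      Allₚ.concat⁺ (Allₚ.map⁺ (All.map (insertions⊑ (⊑-≤ (<⇒≤ (<-trans n<m m<M)) M⊑1))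
                                       (permutations-lines (<⇒≤ n<m))))

    -- Stage n multiplies the number of lists by n + 1, which is at most M.
    length-permutations : ∀ {n} → n ≤ m → length (permutations n) ≤ M ^ n
    length-permutations {zero}  _   = ≤-refl
    length-permutations {suc n} n<m =
      ≤-trans (length-concatMap-≤ (insertions n) (permutations n)
                (All.map (λ {ys} (l , _) → ≤-reflexive (trans (length-insertions n ys) (cong suc l)))
                         (permutations-lines (<⇒≤ n<m))))
        (subst (length (permutations n) * suc n ≤_) (*-comm (M ^ n) M)
          (*-mono-≤ (length-permutations (<⇒≤ n<m)) (≤-trans n<m (<⇒≤ m<M))))

    permutationsᵗ⇓ : {t : Tm ⟦_⟧ nat} → t ⇓ k ∥ a → k ≤ m → permutationsᵗ t ⇓ permutations k ∥ _
    permutationsᵗ⇓ {k} t⇓ k≤m =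
      recNat⇓ permutations t⇓ (cons⇓ nil⇓ nil⇓) (λ i≤k → size (≤-trans i≤k k≤m))
        λ _ i⇓ r⇓ → concatMapᵗ⇓ (insertionsᵗ⇓ i⇓) r⇓
      where
      size : ∀ {i} → i ≤ m → Sized (list (list nat)) (permutations i) 1
      size i≤m =
        ⊑-≤ (≤-trans (length-permutations i≤m) (^-monoʳ-≤ M (≤-trans i≤m (<⇒≤ m<M)))) M^M⊑1 ,
        All.map (λ (l , es) → ⊑-≤ (≤-trans (≤-reflexive l) (≤-trans i≤m (<⇒≤ m<M))) M⊑1 , es)
                (permutations-lines i≤m)

    Sized-vertices : k ≤ m → All (λ v → Sized (bool ⊗ nat) v 1) (vertices k)
    Sized-vertices {k} k≤m = Allₚ.++⁺ (Allₚ.map⁺ rows) (Allₚ.map⁺ rows)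
      where
      rows : All (λ i → ⊤ × i ⊑ 1) (upTo k)
      rows = Allₚ.applyUpTo⁺₁ (λ i → i) k λ i<k → tt , ⊑-≤ (<⇒≤ (<-trans (<-≤-trans i<k k≤m) m<M)) M⊑1

    length-vertices-≤ : k ≤ m → length (vertices k) ≤ M * M
    length-vertices-≤ {k} k≤m =
      subst (_≤ M * M) (sym (length-vertices k)) (*-mono-≤ 2≤M (≤-trans k≤m (<⇒≤ m<M)))

    [M*M]^2M⊑4 : (M * M) ^ (2 * M) ⊑ 4
    [M*M]^2M⊑4 = subst (_⊑ 4) (sym (^-distribʳ-* (2 * M) M M)) (M^2M⊑2 ⊛ M^2M⊑2)
      where
      M^2M⊑2 : M ^ (2 * M) ⊑ 2
      M^2M⊑2 = subst (_⊑ 2) (sym (^-distribˡ-+-* M M (M + 0)))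
        (M^M⊑1 ⊛ subst (λ n → M ^ n ⊑ 1) (sym (+-identityʳ M)) M^M⊑1)

    -- Exponent 4 suffices for the number of paths, 3 for their lengths and 1 for the vertices drawn
    -- from the list, so 6 covers all three with room to spare; `e` accounts for the start s. Each
    -- path has at most M² extensions, one per listed vertex.
    simplePaths-size : ∀ es s {e n} → k ≤ m → n ≤ 2 * M → Sized (bool ⊗ nat) s e →
                       Sized (list (list (bool ⊗ nat))) (simplePaths es (vertices k) s n) (e ⊔ 6)
    simplePaths-size {k} es s {e} {n} k≤m n≤2M s⊑ =
      ⊑-mono (m≤n⇒m≤o⊔n e (s≤s (s≤s (s≤s (s≤s z≤n)))))
        (⊑-≤ (≤-trans (count n) (^-monoʳ-≤ (M * M) ⦃ m*n≢0 M M ⦄ n≤2M)) [M*M]^2M⊑4) ,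
      All.map (λ (l , vs) → subst (_⊑ _) (sym l) n+1⊑ , vs) (elements n)
      where
      n+1⊑ : suc n ⊑ e ⊔ 6
      n+1⊑ = ⊑-mono (m≤n⇒m≤o⊔n e (s≤s (s≤s (s≤s z≤n)))) (1⊑0 ⊕ ⊑-≤ n≤2M (2⊑1 ⊛ M⊑1))
      Node⊑ : Vertex → Set
      Node⊑ v = Sized (bool ⊗ nat) v (e ⊔ 6)
      vs⊑ : All Node⊑ (vertices k)
      vs⊑ = All.map (λ {v} → Sized-mono (bool ⊗ nat) {v = v} (m≤n⇒m≤o⊔n e (s≤s z≤n))) (Sized-vertices k≤m)
      elements : ∀ n → All (λ p → length p ≡ suc n × All Node⊑ p) (simplePaths es (vertices k) s n)
      elements zero    = (refl , Sized-mono (bool ⊗ nat) {v = s} (m≤m⊔n e 6) s⊑ ∷ []) ∷ []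
      elements (suc n) = Allₚ.concat⁺ (Allₚ.map⁺ (All.map
        (λ {p} (l , ps) → Allₚ.map⁺ (All.map (λ q → cong suc l , q ∷ ps) (Allₚ.filter⁺ (extends? es p) vs⊑)))
        (elements n)))
      count : ∀ n → length (simplePaths es (vertices k) s n) ≤ (M * M) ^ n
      count zero    = ≤-refl
      count (suc n) = ≤-trans
        (length-concatMap-≤ _ (simplePaths es (vertices k) s n)
          (All.universal (λ p → ≤-trans (≤-reflexive (length-map (_∷ p) (filter (extends? es p) (vertices k))))
            (≤-trans (length-filter (extends? es p) (vertices k)) (length-vertices-≤ k≤m))) _))
        (subst (length (simplePaths es (vertices k) s n) * (M * M) ≤_) (*-comm ((M * M) ^ n) (M * M))
          (*-monoˡ-≤ (M * M) (count n)))

    simplePathsᵗ⇓ : {t : Tm ⟦_⟧ (list (nat ⊗ nat))} {u : Tm ⟦_⟧ (list (bool ⊗ nat))} {w : Tm ⟦_⟧ (bool ⊗ nat)}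
                    {r : Tm ⟦_⟧ nat}
                    {es : EdgeList} {s : Vertex} {l : ℕ} →
                    t ⇓ es ∥ a → u ⇓ vertices k ∥ b → w ⇓ s ∥ c → r ⇓ l ∥ d → k ≤ m → l ≤ 2 * M →
                    simplePathsᵗ t u w r ⇓ simplePaths es (vertices k) s l ∥ _
    simplePathsᵗ⇓ {k = k} {b = b} {c = c} {es = es} {s} {l} t⇓ u⇓ w⇓ r⇓ k≤m l≤ =
      recNat⇓ (simplePaths es (vertices k) s) r⇓ (cons⇓ (cons⇓ w⇓ nil⇓) nil⇓)
        (λ i≤l → simplePaths-size es s k≤m (≤-trans i≤l l≤) (sized w⇓))
        λ _ _ p⇓ → concatMapᵗ⇓ (λ q⇓ → mapᵗ⇓ (λ v⇓ → cons⇓ v⇓ q⇓)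
          (filterᵗ⇓ (λ v⇓ → ∧ᵗ⇓ (headAdjacentᵗ⇓ t⇓ v⇓ q⇓) (notᵗ⇓ (anyᵗ⇓ (sameVertexᵗ⇓ v⇓) q⇓))) u⇓)) p⇓

    hasCycleᵗ⇓ : {t : Tm ⟦_⟧ (list (nat ⊗ nat))} {u : Tm ⟦_⟧ (list (bool ⊗ nat))} {r : Tm ⟦_⟧ nat}
                    {es : EdgeList} {l : ℕ} →
                    t ⇓ es ∥ a → u ⇓ vertices k ∥ b → r ⇓ l ∥ d → k ≤ m → l ≤ 2 * M →
                    hasCycleᵗ t u r ⇓ does (hasCycle? es (vertices k) l) ∥ _
    hasCycleᵗ⇓ {l = l} t⇓ u⇓ r⇓ k≤m l≤ = ∧ᵗ⇓ (lt⇓ lit2⇓ r⇓)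
      (anyᵗ⇓ (λ s⇓ → anyᵗ⇓ (headAdjacentᵗ⇓ t⇓ s⇓)
        (simplePathsᵗ⇓ t⇓ u⇓ s⇓ (sub⇓ r⇓ lit1⇓) k≤m (≤-trans (m∸n≤m l 1) l≤))) u⇓)

    partitionIsFullᵗ⇓ : ∀ {t u n q} → t ⇓ n ∥ a → u ⇓ q ∥ b → n ≤ m →
                        partitionIsFullᵗ t u ⇓ does (full? n q) ∥ _
    partitionIsFullᵗ⇓ t⇓ u⇓ n≤m =
      ∧ᵗ⇓ (compatibleᵗ⇓ u⇓ (upToᵗ⇓ t⇓))
          (bind⇓ (++ᵗ⇓ (onesᵗ⇓ u⇓) (onesᵗ⇓ (upToᵗ⇓ t⇓))) λ es⇓ →
           bind⇓ (verticesᵗ⇓ t⇓) λ vs⇓ →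
           hasCycleᵗ⇓ es⇓ vs⇓ (mul⇓ lit2⇓ t⇓) n≤m (*-monoʳ-≤ 2 (≤-trans n≤m (<⇒≤ m<M))))

    girthᵗ⇓ : ∀ {t u es} → t ⇓ m ∥ a → u ⇓ es ∥ b → girthᵗ t u ⇓ girth m es ∥ _
    girthᵗ⇓ t⇓ u⇓ =
      bind⇓ u⇓ λ es⇓ →
      bind⇓ (verticesᵗ⇓ t⇓) λ vs⇓ →
      bind⇓ (add⇓ (mul⇓ lit2⇓ t⇓) lit1⇓) λ bound⇓ →
      caseMaybe⇓
        (leastᵗ⇓ bound⇓ λ {i} i<bound i⇓ → hasCycleᵗ⇓ es⇓ vs⇓ i⇓ ≤-refl (i≤2M i<bound))
        bound⇓ λ _ l⇓ → l⇓
      where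
      i≤2M : ∀ {i} → i < 2 * m + 1 → i ≤ 2 * M
      i≤2M {i} i<bound = ≤-trans (<⇒≤pred (subst (i <_) (+-comm (2 * m) 1) i<bound)) (*-monoʳ-≤ 2 (<⇒≤ m<M))

    Sized-best : ∀ {xs} → Sized (list (nat ⊗ list nat)) xs i → Sized (maybe (nat ⊗ list nat)) (best xs) i
    Sized-best {xs = []}     _             = nothing
    Sized-best {xs = x ∷ xs} σ@(_ , τ ∷ _) with best xs | Sized-best {xs = xs} (Sized-tail σ)
    ... | nothing | _      = just τ
    ... | just y  | just υ with does (proj₁ y <? proj₁ x)
    ...   | true  = just τ
    ...   | false = just υ

    -- The premise on `b′ * k` keeps the permutations enumerated, and the paths in their BTUs,
    -- within the bounds for at most m points.
    searchᵗ⇓ : ∀ {t u v w b′ k j} → t ⇓ m ∥ a → u ⇓ b′ ∥ b → v ⇓ k ∥ c → w ⇓ j ∥ d → b′ * k ≤ m →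
               searchᵗ t u v w ⇓ searchResult m b′ k j ∥ _
    searchᵗ⇓ t⇓ u⇓ v⇓ w⇓ n≤m =
      bind⇓ (mul⇓ u⇓ v⇓) λ n⇓ →
      bind⇓ (upToᵗ⇓ t⇓) λ p₂⇓ →
      bind⇓ (shiftᵗ⇓ t⇓ w⇓) λ p₃⇓ →
      bind⇓ (mapᵗ⇓ (blocksᵗ⇓ v⇓ n⇓) (filterᵗ⇓ (λ q⇓ → partitionIsFullᵗ⇓ n⇓ q⇓ n≤m)
                                            (permutationsᵗ⇓ n⇓ n≤m))) λ p₁s⇓ →
      bind⇓ (filterᵗ⇓ (λ p₁⇓ → ∧ᵗ⇓ (compatibleᵗ⇓ p₁⇓ p₂⇓) (∧ᵗ⇓ (compatibleᵗ⇓ p₁⇓ p₃⇓) (compatibleᵗ⇓ p₂⇓ p₃⇓)))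
                      p₁s⇓) λ good⇓ →
      bind⇓ (mapᵗ⇓ (λ p₁⇓ → pair⇓ (girthᵗ⇓ t⇓ (++ᵗ⇓ (onesᵗ⇓ p₁⇓) (++ᵗ⇓ (onesᵗ⇓ p₂⇓) (onesᵗ⇓ p₃⇓)))) p₁⇓)
                   good⇓) λ scored⇓ →
      caseMaybe⇓
        (recList⇓ best scored⇓ none⇓ Sized-best λ x⇓ _ best⇓ →
          caseMaybe⇓ best⇓ (some⇓ x⇓) λ _ y⇓ → ite⇓ (lt⇓ (fst⇓ y⇓) (fst⇓ x⇓)) (some⇓ x⇓) (some⇓ y⇓))
        none⇓ λ _ x⇓ → some⇓ (pair⇓ (snd⇓ x⇓) (pair⇓ p₂⇓ p₃⇓))

    algorithm⇓ : enumerationSearch m ⇓ algorithm m ∥ _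
    algorithm⇓ =
      bind⇓ (var⇓ {i = 1} (⊑-≤ (<⇒≤ m<M) M⊑1)) λ m⇓ →
      bind⇓ (add⇓ m⇓ lit1⇓) λ m+1⇓ →
      caseMaybe⇓ (leastᵗ⇓ m+1⇓ λ _ b⇓ → anyᵗ⇓ (λ k⇓ → eq⇓ m⇓ (mul⇓ b⇓ (mul⇓ k⇓ k⇓))) (upToᵗ⇓ m+1⇓))
                 none⇓ λ {b} _ b⇓ →
      caseMaybe⇓ (leastᵗ⇓ m+1⇓ λ _ k⇓ → eq⇓ m⇓ (mul⇓ b⇓ (mul⇓ k⇓ k⇓))) none⇓ λ {k} k≡ k⇓ →
      bind⇓ (mul⇓ b⇓ k⇓) λ n⇓ →
      caseMaybe⇓ (leastᵗ⇓ m⇓ λ _ j⇓ → ∧ᵗ⇓ (coprimeᵗ⇓ j⇓ m⇓) (∧ᵗ⇓ (lt⇓ n⇓ j⇓) (lt⇓ n⇓ (sub⇓ m⇓ j⇓))))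
                 none⇓ λ _ j⇓ →
      -- The search for k succeeded, so m = b k² and therefore b k is at most m.
      searchᵗ⇓ {b′ = b} {k} m⇓ b⇓ k⇓ j⇓ (square⇒b*k≤m b k (proj₁ (proj₂ (least-just _ (m + 1) k≡))))

-- With M = m + 2, B = 2^(M²) is at least M^M, hence bounds m!, and B⁴ bounds the
-- number (M²)^(2M) of simple paths.
base : ℕ → ℕ
base m = 2 ^ ((2 + m) * (2 + m))

2≤base : ∀ m → 2 ≤ base m
2≤base m = ^-monoʳ-≤ 2 {1} {(2 + m) * (2 + m)} (s≤s z≤n)

n≤2^n : ∀ n → n ≤ 2 ^ n
n≤2^n zero    = z≤n
n≤2^n (suc n) = subst (suc n ≤_) (cong (2 ^ n +_) (sym (+-identityʳ (2 ^ n)))) (+-mono-≤ (m^n>0 2 n) (n≤2^n n))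

M^M≤base : ∀ m → (2 + m) ^ (2 + m) ≤ base m
M^M≤base m = subst ((2 + m) ^ (2 + m) ≤_) (^-*-assoc 2 (2 + m) (2 + m)) (^-monoˡ-≤ (2 + m) (n≤2^n (2 + m)))

module _ (m : ℕ) where
  open Bounds (base m) (2≤base m)
  open Calculus (base m) (2≤base m)

  enumerationSearch⇓ : enumerationSearch m ⇓ algorithm m ∥ _
  enumerationSearch⇓ = Exponential.algorithm⇓ m (2 + m) ≤-refl
    (bounded (subst ((2 + m) ^ (2 + m) ≤_) (sym (^-identityʳ (base m))) (M^M≤base m)))

-- The code `c` is fixed before m varies, and this makes its exponent a constant although the base
-- depends on m.
evaluates-in-EXPTIME : ∀ {β} (p : Program nat β) {v : ℕ → ⟦ β ⟧} {c} →
  (∀ m → Calculus._⇓_∥_ (base m) (2≤base m) (p m) (v m) c) → In-EXPTIME p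
-- These are the coefficients of E (m + 2)².
evaluates-in-EXPTIME p {c = c} p⇓ = (4 * E ∷ 4 * E ∷ E ∷ []) , λ m _ _ _ →
  subst (steps p m ≤_) (trans (^-*-assoc 2 ((2 + m) * (2 + m)) E) (cong (2 ^_) (square m)))
    (Bounds.bound (Calculus.time⊑ (p⇓ m)))
  where
  E = expo c
  open +-*-Solver
  square : ∀ m → (2 + m) * (2 + m) * E ≡ (4 * E ∷ 4 * E ∷ E ∷ []) at m
  square m = solve 2 (λ m E → (con 2 :+ m) :* (con 2 :+ m) :* E :=
    con 4 :* E :+ m :* (con 4 :* E :+ m :* (E :+ m :* con 0))) refl m E

search-in-EXPTIME : In-EXPTIME enumerationSearch
search-in-EXPTIME = evaluates-in-EXPTIME enumerationSearch enumerationSearch⇓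

output≡algorithm : ∀ m → output enumerationSearch m ≡ algorithm m
output≡algorithm m = Calculus.value≡ (enumerationSearch⇓ m)

corollary3 : Implements-search enumerationSearch × In-EXPTIME enumerationSearch
corollary3 = (λ m b k A → subst (IsOutput A) (sym (output≡algorithm m)) (algorithm-isOutput A)) , search-in-EXPTIME
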